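{- Let $(\phi_0,\phi_1)\colon(X,S)\to(X',S')$ be a surjective admissible morphism of association schemes, and let $(\lambda_1,\dots,\lambda_m)$, $m=|S'|$, be the vector of the eigenvalues of $O_{(X',S')}$ (counting multiplicities). Then there is a positive integer $k$ such that $(k\lambda_1,\dots,k\lambda_m)$ is a subvector of the vector of the eigenvalues (counting multiplicities) of $O_{(X,S)}$; i.e. the multiset $\{k\lambda_1,\dots,k\lambda_m\}$ is contained, with multiplicities, in the multiset of eigenvalues of $O_{(X,S)}$.
   Context: A coherent configuration $(X,S)$ is a finite set $X$ with a partition $S$ of $X\times X$ such that: if $p\in S$ contains some $(x,x)$ then $p\subseteq\mathrm{id}_X$; for $a,b,c\in S$ the number $\nabla_{ab}^c$ of $z\in X$ with $(x,z)\in a$, $(z,y)\in b$ is the same for all $(x,y)\in c$; and $c\in S$ implies $c^{ -1}=\{(y,x):(x,y)\in c\}\in S$. It is an association scheme (scheme) if $\mathrm{id}_X\in S$. The valency $\|a\|$ of $a\in S$ is the number of $y\in X$ with $(x,y)\in a$, for any $x$ for which at least one such $y$ exists (independent of $x$). Put $\dot\nabla_{ab}^c=\sqrt{\frac{\|c\|}{\|a\|\|b\|}}\,\nabla_{ab}^c$. The matrix $O_{(X,S)}=\dot\nabla\circ\dot\nabla^\dagger$ is the real symmetric $S\times S$ matrix with entries $O_a^b=\sum_{p,q\in S}\dot\nabla_{pq}^a\dot\nabla_{pq}^b$. A morphism $(X,S)\to(X',S')$ is a pair of maps $\phi_0\colon X\to X'$, $\phi_1\colon S\to S'$ such that $(x,y)\in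 a$ implies $(\phi_0(x),\phi_0(y))\in\phi_1(a)$. It is admissible if for all $x\in X$, $y'\in X'$, $a\in S$ such that there is some $w\in X$ with $(x,w)\in a$, and such that $(\phi_0(x),y')\in\phi_1(a)$, there exists $y\in X$ with $\phi_0(y)=y'$ and $(x,y)\in a$. (For association schemes the condition that such a $w$ exists is automatic.) Surjective means that $\phi_0$ and $\phi_1$ are surjective. -}

module Defs where

open import Algebra.Bundles using (CommutativeRing; Semiring)
open import Algebra.Core using (Op₁; Op₂)
open import Data.Fin.Base using (Fin; zero; suc; toℕ; punchIn)
open import Data.Fin.Properties using (_≟_)
open import Data.Nat.Base using (ℕ; zero; suc)
open import Data.Product.Base using (∃; ∃₂; _×_; proj₁; proj₂)
open import Data.Vec.Base using (count; allFin)
open import Data.Vec.Functional using (Vector)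
open import Function.Bundles using (_⇔_)
open import Function.Definitions using (Injective; StrictlySurjective)
open import Level using (Level; _⊔_) renaming (suc to lsuc)
open import Relation.Binary.Core using (Rel)
open import Relation.Binary.PropositionalEquality.Core using (_≡_)
open import Relation.Binary.Structures using (IsDecTotalOrder)
open import Relation.Nullary.Decidable.Core using (yes; no; _×-dec_)
open import Relation.Nullary.Negation.Core using (¬_)
open import Relation.Unary using (Pred; Satisfiable)

-- The real numbers, given axiomatically as a Dedekind-complete ordered field
-- with (classically) decidable order; classically these axioms determine ℝ up
-- to unique isomorphism.  The values 0# ⁻¹ and √ x for x < 0# are unspecified
-- and play no role: below, inverses are only taken of products of valencies,
-- which are positive.  √ is determined by the other data.
record Reals (c ℓ₁ ℓ₂ : Level) : Set (lsuc (c ⊔ ℓ₁ ⊔ ℓ₂)) where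
  field
    commutativeRing : CommutativeRing c ℓ₁

  open CommutativeRing commutativeRing public

  infix  4 _≤_
  infix  8 _⁻¹ √_
  infixl 7 _/_

  field
    _≤_             : Rel Carrier ℓ₂
    isDecTotalOrder : IsDecTotalOrder _≈_ _≤_
    +-monoˡ-≤       : ∀ {x y} z → x ≤ y → x + z ≤ y + z
    *-nonNeg        : ∀ {x y} → 0# ≤ x → 0# ≤ y → 0# ≤ x * y
    0≉1             : ¬ (0# ≈ 1#)
    _⁻¹             : Op₁ Carrier
    ⁻¹-inverseʳ     : ∀ {x} → ¬ (x ≈ 0#) → x * x ⁻¹ ≈ 1#
    √_              : Op₁ Carrier
    √-nonNeg        : ∀ {x} → 0# ≤ x → 0# ≤ √ x
    √-square        : ∀ {x} → 0# ≤ x → √ x * √ x ≈ x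

  IsUpperBound : Pred Carrier (c ⊔ ℓ₁ ⊔ ℓ₂) → Carrier → Set (c ⊔ ℓ₁ ⊔ ℓ₂)
  IsUpperBound P b = ∀ {x} → P x → x ≤ b

  field
    complete : (P : Pred Carrier (c ⊔ ℓ₁ ⊔ ℓ₂)) → Satisfiable P → ∃ (IsUpperBound P) →
               ∃ λ l → IsUpperBound P l × (∀ b → IsUpperBound P b → l ≤ b)

  _/_ : Op₂ Carrier
  x / y = x * y ⁻¹

-- The underlying set is Fin n and the parts of the partition of its square are
-- indexed by Fin s: (x , y) lies in the part a iff colour x y ≡ a.  The parts
-- of a partition are nonempty, so colour is surjective.
record CoherentConfiguration (n s : ℕ) : Set where
  field
    colour   : Fin n → Fin n → Fin s
    nonempty : ∀ a → ∃₂ λ x y → colour x y ≡ a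

  paths : Fin s → Fin s → Fin n → Fin n → ℕ
  paths a b x y = count (λ z → (colour x z ≟ a) ×-dec (colour z y ≟ b)) (allFin n)

  field
    diagonal : ∀ p {x} → colour x x ≡ p → ∀ {y z} → colour y z ≡ p → y ≡ z
    regular  : ∀ a b c {x y x′ y′} → colour x y ≡ c → colour x′ y′ ≡ c →
               paths a b x y ≡ paths a b x′ y′
    converse : ∀ c → ∃ λ c′ → ∀ x y → colour y x ≡ c′ ⇔ colour x y ≡ c

  source target : Fin s → Fin n
  source a = proj₁ (nonempty a)
  target a = proj₁ (proj₂ (nonempty a))

  -- ∇ a b c is the number ∇_{ab}^c, computed at a chosen pair in c; by
  -- regularity the choice is immaterial.
  ∇ : Fin s → Fin s → Fin s → ℕ
  ∇ a b c = paths a b (source c) (target c)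

  -- Likewise independent of the choice of a first component of a pair in a.
  ‖_‖ : Fin s → ℕ
  ‖ a ‖ = count (λ y → colour (source a) y ≟ a) (allFin n)

IsAssociationScheme : ∀ {n s} → CoherentConfiguration n s → Set
IsAssociationScheme 𝒳 = ∃ λ i → ∀ x y → colour x y ≡ i ⇔ x ≡ y
  where open CoherentConfiguration 𝒳

record Morphism {n s n′ s′} (𝒳 : CoherentConfiguration n s)
                (𝒳′ : CoherentConfiguration n′ s′) : Set where
  private
    module 𝒳  = CoherentConfiguration 𝒳
    module 𝒳′ = CoherentConfiguration 𝒳′
  field
    φ₀        : Fin n → Fin n′
    φ₁        : Fin s → Fin s′
    preserves : ∀ x y a → 𝒳.colour x y ≡ a → 𝒳′.colour (φ₀ x) (φ₀ y) ≡ φ₁ a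

  IsAdmissible : Set
  IsAdmissible = ∀ x y′ a → (∃ λ w → 𝒳.colour x w ≡ a) →
                 𝒳′.colour (φ₀ x) y′ ≡ φ₁ a →
                 ∃ λ y → φ₀ y ≡ y′ × 𝒳.colour x y ≡ a

  IsSurjective : Set
  IsSurjective = StrictlySurjective _≡_ φ₀ × StrictlySurjective _≡_ φ₁

module LinearAlgebra {c ℓ₁ ℓ₂} (ℝ : Reals c ℓ₁ ℓ₂) where
  open Reals ℝ hiding (zero)
  open import Algebra.Definitions.RawSemiring (Semiring.rawSemiring semiring) public
    using (sum; product; _^_) renaming (_×_ to _·_)

  Matrix : ℕ → Set c
  Matrix m = Fin m → Fin m → Carrier

  -- Laplace expansion along the first row.
  det : ∀ {m} → Matrix m → Carrier
  det {zero}  M = 1#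
  det {suc m} M =
    sum λ j → (- 1#) ^ toℕ j * (M zero j * det λ i k → M (suc i) (punchIn j k))

  identity : ∀ {m} → Matrix m
  identity i j with i ≟ j
  ... | yes _ = 1#
  ... | no  _ = 0#

  charPoly : ∀ {m} → Matrix m → Carrier → Carrier
  charPoly M t = det λ i j → t * identity i j - M i j

  -- v lists the eigenvalues of M with (algebraic) multiplicities, i.e.
  -- det (t I - M) = ∏ᵢ (t - vᵢ).  As the field is infinite, equality of the two
  -- polynomials is the same as equality of their values at all t.
  IsEigenvalueVector : ∀ {m} → Matrix m → Vector Carrier m → Set (c ⊔ ℓ₁)
  IsEigenvalueVector M v = ∀ t → charPoly M t ≈ product λ i → t - v i

  -- Containment of multisets: the entries of v occur in w at distinct positions.
  IsSubvector : ∀ {m n} → Vector Carrier m → Vector Carrier n → Set ℓ₁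
  IsSubvector {m} {n} v w =
    ∃ λ (ι : Fin m → Fin n) → Injective _≡_ _≡_ ι × (∀ i → w (ι i) ≈ v i)

  module _ {n s} (𝒳 : CoherentConfiguration n s) where
    open CoherentConfiguration 𝒳

    ∇̇ : Fin s → Fin s → Fin s → Carrier
    ∇̇ a b c = √ ((‖ c ‖ · 1#) / ((‖ a ‖ · 1#) * (‖ b ‖ · 1#))) * (∇ a b c · 1#)

    O : Matrix s
    O a b = sum λ p → sum λ q → ∇̇ p q a * ∇̇ p q b

{-# OPTIONS --safe #-}

-- Write w_a = ‖a‖, and let k be the common size of the fibres of φ₀.  By
-- admissibility, a point with an a-neighbour in a given fibre has exactly
-- m_a = w_a / w′_{φ a} of them there, so A_a ↦ m_a A′_{φ a} is a homomorphism
-- of adjacency algebras.  In the orthonormal bases A_a / √w_a it is the matrix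
-- P with P_{a′a} = √m_a for φ a = a′ and 0 otherwise, and since O = μ μ† for
-- the multiplication μ, counting paths fibrewise gives P O = k O′ P.  As P has
-- full row rank, O is similar to a block triangular matrix with diagonal block
-- k O′, so charPoly (k O′) divides charPoly O.
module Submission where

open import Defs
open import Data.Fin.Base using (Fin; zero; suc; toℕ; punchIn; punchOut; inject₁; _↑ˡ_; _↑ʳ_; splitAt)
  renaming (_≤_ to _≤ᶠ_)
open import Data.Fin.Permutation using (Permutation; _⟨$⟩ʳ_; insert; insert-punchIn; ↔⇒≡) renaming (id to idₚ)
open import Data.Fin.Properties
  using (_≟_; any?; punchInᵢ≢i; punchIn-injective; punchIn-punchOut; punchOut-injective; suc-injective;
         toℕ-↑ˡ; ↑ˡ-injective; ↑ʳ-injective; splitAt-↑ˡ; splitAt-↑ʳ)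
open import Data.Nat.Base using (ℕ; zero; suc; _<_; z≤n; s≤s) renaming (_+_ to _ℕ+_; _⊔_ to _ℕ⊔_)
open import Data.Nat.Properties using (m<n⇒n≢0)
open import Data.Product.Base using (∃; ∃₂; _×_; _,_; proj₁; proj₂)
open import Data.Sum.Base using (inj₁; inj₂)
open import Data.Vec.Base using (count; tabulate; allFin)
open import Data.Vec.Functional using (Vector; _∷_; _++_; insertAt; head; tail)
open import Data.Vec.Functional.Properties using (insertAt-lookup; insertAt-punchIn; lookup-++ˡ; lookup-++ʳ)
open import Function.Base using (_∘_; id)
open import Function.Bundles using (Equivalence; Injection)
open import Function.Definitions using (Injective)
open import Function.Properties.Inverse using (↔⇒↣)
open import Level using (_⊔_)
open import Relation.Binary.PropositionalEquality as ≡ using (_≡_; _≢_)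
open import Relation.Binary.Structures using (IsDecTotalOrder)
open import Relation.Nullary.Decidable.Core using (Dec; yes; no; _×-dec_)
open import Relation.Nullary.Negation.Core using (¬_; contradiction)
open import Relation.Unary using (Decidable)

-- Why the factor is exactly k: let R be the tensor square of P. The homomorphism property reads P μ
-- = μ′ R, and R μ† = k μ′† P because each intermediate point of a path below has k lifts. Hence P μ
-- μ† = k μ′ μ′† P. Square roots would get in the way of this counting, so they are split off first:
-- `O` has entries r a * r b * N a b, with `N` built from structure constants and inverse valencies
-- alone. No spectral theory enters. Eigenvalues occur only through a factorisation of the
-- characteristic polynomial, so everything rests on determinants; the product rule is drawn from
-- the Laplace expansion through the uniqueness of alternating forms. Passing from divisibility to
-- containment of multisets removes one root at a time. The identities are between functions of t,
-- so cancelling t - b loses the value at t = b; it is recovered because a polynomial that vanishes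
-- on a half line is zero.

-- Finite index sets: deleting, splitting and reordering indices

punchIn-inject₁-≤ : ∀ {n} (a b : Fin n) → a ≤ᶠ b → punchIn (inject₁ a) b ≡ suc b
punchIn-inject₁-≤ zero    b       _         = ≡.refl
punchIn-inject₁-≤ (suc a) (suc b) (s≤s a≤b) = ≡.cong suc (punchIn-inject₁-≤ a b a≤b)

punchIn-suc-≤ : ∀ {n} (a b : Fin n) → a ≤ᶠ b → punchIn (suc b) a ≡ inject₁ a
punchIn-suc-≤ zero    b       _         = ≡.refl
punchIn-suc-≤ (suc a) (suc b) (s≤s a≤b) = ≡.cong suc (punchIn-suc-≤ a b a≤b)

-- The columns a and b + 1 can be deleted in either order; the second deletion is named relative to
-- what the first one leaves. This pairs the terms of a double Laplace expansion.
punchIn-punchIn : ∀ {n} (a b : Fin (suc n)) → a ≤ᶠ b → ∀ l →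
                  punchIn (inject₁ a) (punchIn b l) ≡ punchIn (suc b) (punchIn a l)
punchIn-punchIn zero    b       _         l       = ≡.refl
punchIn-punchIn (suc a) (suc b) (s≤s a≤b) zero    = ≡.refl
punchIn-punchIn (suc a) (suc b) (s≤s a≤b) (suc l) = ≡.cong suc (punchIn-punchIn a b a≤b l)

punchIn-elim : ∀ {n p} (P : Fin (suc n) → Set p) (j : Fin (suc n)) →
               P j → (∀ k → P (punchIn j k)) → ∀ i → P i
punchIn-elim P zero    Pj P↑ zero    = Pj
punchIn-elim P zero    Pj P↑ (suc i) = P↑ i
punchIn-elim {suc n} P (suc j) Pj P↑ zero    = P↑ zero
punchIn-elim {suc n} P (suc j) Pj P↑ (suc i) = punchIn-elim (P ∘ suc) j Pj (P↑ ∘ suc) i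

↑-elim : ∀ m {n p} (P : Fin (m ℕ+ n) → Set p) →
         (∀ i → P (i ↑ˡ n)) → (∀ j → P (m ↑ʳ j)) → ∀ i → P i
↑-elim zero    P Pˡ Pʳ i       = Pʳ i
↑-elim (suc m) P Pˡ Pʳ zero    = Pˡ zero
↑-elim (suc m) P Pˡ Pʳ (suc i) = ↑-elim m (P ∘ suc) (Pˡ ∘ suc) Pʳ i

punchIn-↑ˡ-↑ˡ : ∀ {m} n (j : Fin (suc m)) (k : Fin m) →
                punchIn (j ↑ˡ n) (k ↑ˡ n) ≡ punchIn j k ↑ˡ n
punchIn-↑ˡ-↑ˡ n zero    k       = ≡.refl
punchIn-↑ˡ-↑ˡ n (suc j) zero    = ≡.refl
punchIn-↑ˡ-↑ˡ n (suc j) (suc k) = ≡.cong suc (punchIn-↑ˡ-↑ˡ n j k)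

punchIn-↑ˡ-↑ʳ : ∀ {m n} (j : Fin (suc m)) (k : Fin n) →
                punchIn (j ↑ˡ n) (m ↑ʳ k) ≡ suc m ↑ʳ k
punchIn-↑ˡ-↑ʳ         zero    k = ≡.refl
punchIn-↑ˡ-↑ʳ {suc m} (suc j) k = ≡.cong suc (punchIn-↑ˡ-↑ʳ j k)

↑ˡ≢↑ʳ : ∀ {m n} (i : Fin m) (j : Fin n) → i ↑ˡ n ≢ m ↑ʳ j
↑ˡ≢↑ʳ {m} {n} i j eq with
  ≡.trans (≡.sym (splitAt-↑ˡ m i n)) (≡.trans (≡.cong (splitAt m) eq) (splitAt-↑ʳ m n j))
... | ()

-- Renumbers the indices so that the range of σ comes first, as block matrices require. Induction on
-- m: place `σ zero`, delete that value, and treat the remaining values in the smaller set.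
extend-to-permutation : ∀ {m n} (σ : Fin m → Fin n) → Injective _≡_ _≡_ σ →
  ∃₂ λ r (π : Permutation (m ℕ+ r) n) → ∀ i → π ⟨$⟩ʳ (i ↑ˡ r) ≡ σ i
extend-to-permutation {zero}  {n}     σ inj = n , idₚ , λ ()
extend-to-permutation {suc m} {zero}  σ inj with σ zero
... | ()
extend-to-permutation {suc m} {suc n} σ inj =
  let r , π , π≡ = extend-to-permutation (λ i → punchOut (σ₀≢ i))
                     (λ eq → suc-injective (inj (punchOut-injective (σ₀≢ _) (σ₀≢ _) eq)))
  in r , insert zero (σ zero) π , λ
    { zero    → ≡.refl
    ; (suc i) → ≡.trans (insert-punchIn zero (σ zero) π (i ↑ˡ r))
                  (≡.trans (≡.cong (punchIn (σ zero)) (π≡ i)) (punchIn-punchOut (σ₀≢ i)))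
    }
  where
  σ₀≢ : ∀ i → σ zero ≢ σ (suc i)
  σ₀≢ i eq with inj eq
  ... | ()

count-positive : ∀ {n p} {A : Set} {P : A → Set p} (P? : Decidable P) (g : Fin n → A) →
                 ∀ i → P (g i) → 0 < count P? (tabulate g)
count-positive {suc n} P? g i Pgi with P? (g zero)
count-positive {suc n} P? g i       Pgi | yes _ = s≤s z≤n
count-positive {suc n} P? g zero    Pgi | no ¬P = contradiction Pgi ¬P
count-positive {suc n} P? g (suc i) Pgi | no ¬P = count-positive P? (g ∘ suc) i Pgi

module Spectra {c ℓ₁ ℓ₂} (ℝ : Reals c ℓ₁ ℓ₂) where
  open Reals ℝ hiding (zero)
  open LinearAlgebra ℝ
  open IsDecTotalOrder isDecTotalOrder
    using (total; antisym; ≤-respˡ-≈; ≤-respʳ-≈) renaming (_≟_ to _≈?_; refl to ≤-refl; trans to ≤-trans)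
  open import Algebra.Properties.Group +-group using ()
    renaming (x∙y⁻¹≈ε⇒x≈y to x-y≈0⇒x≈y; x≈y⇒x∙y⁻¹≈ε to x≈y⇒x-y≈0;
              inverseˡ-unique to +-inverseˡ-unique; //-rightDividesˡ to x-y+y≈x)
  open import Algebra.Properties.Ring ring
    using (-1*x≈-x; -‿distribˡ-*; -‿distribʳ-*; -0#≈0#; -‿involutive; x[y-z]≈xy-xz; [y-z]x≈yx-zx)
  open import Algebra.Properties.Semiring.Mult semiring using (×-assoc-*; ×-congʳ)
  open import Algebra.Properties.Semiring.Sum semiring
    using (sum-cong-≋; ∑-comm; ∑-distrib-+; *-distribˡ-sum; *-distribʳ-sum; sum-replicate-zero)
  import Algebra.Properties.CommutativeMonoid.Sum *-commutativeMonoid as Product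
  open import Algebra.Solver.Ring.NaturalCoefficients.Default commutativeSemiring
    using (solve; _:=_; _:*_; _:+_)
  open import Relation.Binary.Reasoning.Setoid setoid

  -- Sums against the Kronecker delta

  sum-zero : ∀ {n} {f : Vector Carrier n} → (∀ i → f i ≈ 0#) → sum f ≈ 0#
  sum-zero {n} f≈0 = trans (sum-cong-≋ f≈0) (sum-replicate-zero n)

  identity-yes : ∀ {n} {i j : Fin n} → i ≡ j → identity i j ≡ 1#
  identity-yes {i = i} {j} i≡j with i ≟ j
  ... | yes _  = ≡.refl
  ... | no i≢j = contradiction i≡j i≢j

  identity-no : ∀ {n} {i j : Fin n} → i ≢ j → identity i j ≡ 0#
  identity-no {i = i} {j} i≢j with i ≟ j
  ... | yes i≡j = contradiction i≡j i≢j
  ... | no _    = ≡.refl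

  identity-cong : ∀ {m n} {i j : Fin m} {k l : Fin n} →
                  (i ≡ j → k ≡ l) → (k ≡ l → i ≡ j) → identity i j ≡ identity k l
  identity-cong {i = i} {j} {k} {l} to from with i ≟ j
  ... | yes i≡j = ≡.sym (identity-yes (to i≡j))
  ... | no  i≢j = ≡.sym (identity-no (i≢j ∘ from))

  identity-sym : ∀ {n} (i j : Fin n) → identity i j ≡ identity j i
  identity-sym i j = identity-cong {i = i} {j} {j} {i} ≡.sym ≡.sym

  identity-suc : ∀ {n} (i j : Fin n) → identity (suc i) (suc j) ≡ identity i j
  identity-suc i j = identity-cong {i = suc i} {suc j} {i} {j} (λ { ≡.refl → ≡.refl }) (≡.cong suc)

  -- Behind an indicator factor, an equation is needed on its support only.
  identity-subst : ∀ {n} (i j : Fin n) {x y} → (i ≡ j → x ≈ y) →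
                   identity i j * x ≈ identity i j * y
  identity-subst i j x≈y with i ≟ j
  ... | yes i≡j = *-congˡ (x≈y i≡j)
  ... | no  _   = trans (zeroˡ _) (sym (zeroˡ _))

  sum-identity : ∀ {n} (i : Fin n) (f : Vector Carrier n) →
                 sum (λ j → identity i j * f j) ≈ f i
  sum-identity zero f = begin
    1# * f zero + sum (λ j → 0# * f (suc j)) ≈⟨ +-cong (*-identityˡ _) (sum-zero λ j → zeroˡ (f (suc j))) ⟩
    f zero + 0#                              ≈⟨ +-identityʳ _ ⟩
    f zero                                   ∎
  sum-identity (suc i) f = begin
    0# * f zero + sum (λ j → identity (suc i) (suc j) * f (suc j))
      ≈⟨ +-cong (zeroˡ _) (sum-cong-≋ λ j → *-congʳ (reflexive (identity-suc i j))) ⟩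
    0# + sum (λ j → identity i j * f (suc j))
      ≈⟨ +-identityˡ _ ⟩
    sum (λ j → identity i j * f (suc j))
      ≈⟨ sum-identity i (f ∘ suc) ⟩
    f (suc i) ∎

  sum-identityʳ : ∀ {n} (i : Fin n) (f : Vector Carrier n) →
                  sum (λ j → f j * identity j i) ≈ f i
  sum-identityʳ i f = trans
    (sum-cong-≋ λ j → trans (*-comm _ _) (*-congʳ (reflexive (identity-sym j i))))
    (sum-identity i f)

  -- Double counting: the indices i are grouped by the value h i. Sorting points by colour or by
  -- fibre of `φ₀` always takes this form below.
  sum-fibres : ∀ {m n} (h : Fin n → Fin m) (f : Vector Carrier m) (g : Vector Carrier n) →
               sum (λ i → f (h i) * g i) ≈ sum (λ j → f j * sum (λ i → identity (h i) j * g i))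
  sum-fibres {m} {n} h f g = begin
    sum (λ i → f (h i) * g i)
      ≈⟨ sum-cong-≋ (λ i → *-congʳ (sum-identity (h i) f)) ⟨
    sum (λ i → sum (λ j → identity (h i) j * f j) * g i)
      ≈⟨ sum-cong-≋ (λ i → *-distribʳ-sum {m} (g i) _) ⟩
    sum (λ i → sum (λ j → identity (h i) j * f j * g i))
      ≈⟨ ∑-comm (λ i j → identity (h i) j * f j * g i) ⟩
    sum (λ j → sum (λ i → identity (h i) j * f j * g i))
      ≈⟨ sum-cong-≋ (λ j → sum-cong-≋ λ i →
           solve 3 (λ a b c → a :* b :* c := b :* (a :* c)) refl _ (f j) (g i)) ⟩
    sum (λ j → sum (λ i → f j * (identity (h i) j * g i)))
      ≈⟨ sum-cong-≋ (λ j → *-distribˡ-sum {n} (f j) _) ⟨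
    sum (λ j → f j * sum (λ i → identity (h i) j * g i)) ∎

  -- Ordered fields

  x≤0⇒0≤-x : ∀ {x} → x ≤ 0# → 0# ≤ - x
  x≤0⇒0≤-x {x} x≤0 = ≤-respˡ-≈ (-‿inverseʳ x) (≤-respʳ-≈ (+-identityˡ (- x)) (+-monoˡ-≤ (- x) x≤0))

  0≤x² : ∀ x → 0# ≤ x * x
  0≤x² x with total 0# x
  ... | inj₁ 0≤x = *-nonNeg 0≤x 0≤x
  ... | inj₂ x≤0 = ≤-respʳ-≈ (begin
    - x * - x     ≈⟨ -‿distribˡ-* x (- x) ⟨
    - (x * - x)   ≈⟨ -‿cong (-‿distribʳ-* x x) ⟨
    - - (x * x)   ≈⟨ -‿involutive _ ⟩
    x * x         ∎) (*-nonNeg (x≤0⇒0≤-x x≤0) (x≤0⇒0≤-x x≤0))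

  0≤1 : 0# ≤ 1#
  0≤1 = ≤-respʳ-≈ (*-identityˡ 1#) (0≤x² 1#)

  +-nonNeg : ∀ {x y} → 0# ≤ x → 0# ≤ y → 0# ≤ x + y
  +-nonNeg {x} {y} 0≤x 0≤y = ≤-trans 0≤y (≤-respˡ-≈ (+-identityˡ y) (+-monoˡ-≤ y 0≤x))

  nonNeg-sum≈0 : ∀ {x y} → 0# ≤ x → 0# ≤ y → x + y ≈ 0# → x ≈ 0#
  nonNeg-sum≈0 {x} {y} 0≤x 0≤y x+y≈0 = antisym
    (≤-respʳ-≈ x+y≈0 (≤-respˡ-≈ (+-identityˡ x) (≤-respʳ-≈ (+-comm y x) (+-monoˡ-≤ x 0≤y))))
    0≤x

  ·1-nonNeg : ∀ n → 0# ≤ n · 1#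
  ·1-nonNeg zero    = ≤-refl
  ·1-nonNeg (suc n) = +-nonNeg 0≤1 (·1-nonNeg n)

  -- Ordered fields have characteristic zero. This makes valencies and the fibre size invertible.
  ·1≉0 : ∀ n → n ≢ 0 → ¬ (n · 1# ≈ 0#)
  ·1≉0 zero    n≢0 _    = n≢0 ≡.refl
  ·1≉0 (suc n) n≢0 n≈0 = 0≉1 (sym (nonNeg-sum≈0 0≤1 (·1-nonNeg n) n≈0))

  *-cancelˡ-≈0 : ∀ {x y} → ¬ (x ≈ 0#) → x * y ≈ 0# → y ≈ 0#
  *-cancelˡ-≈0 {x} {y} x≉0 xy≈0 = begin
    y               ≈⟨ *-identityˡ y ⟨
    1# * y          ≈⟨ *-congʳ (⁻¹-inverseʳ x≉0) ⟨
    x * x ⁻¹ * y    ≈⟨ solve 3 (λ a b c → a :* b :* c := b :* (a :* c)) refl x (x ⁻¹) y ⟩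
    x ⁻¹ * (x * y)  ≈⟨ *-congˡ xy≈0 ⟩
    x ⁻¹ * 0#       ≈⟨ zeroʳ _ ⟩
    0#              ∎

  *-cancelˡ-≈ : ∀ {x y z} → ¬ (x ≈ 0#) → x * y ≈ x * z → y ≈ z
  *-cancelˡ-≈ {x} {y} {z} x≉0 xy≈xz = x-y≈0⇒x≈y y z (*-cancelˡ-≈0 x≉0
    (trans (x[y-z]≈xy-xz x y z) (x≈y⇒x-y≈0 xy≈xz)))

  *-≉0 : ∀ {x y} → ¬ (x ≈ 0#) → ¬ (y ≈ 0#) → ¬ (x * y ≈ 0#)
  *-≉0 x≉0 y≉0 = y≉0 ∘ *-cancelˡ-≈0 x≉0

  ⁻¹-nonNeg : ∀ {x} → 0# ≤ x → ¬ (x ≈ 0#) → 0# ≤ x ⁻¹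
  ⁻¹-nonNeg {x} 0≤x x≉0 = ≤-respʳ-≈ (begin
    x * (x ⁻¹ * x ⁻¹) ≈⟨ *-assoc _ _ _ ⟨
    x * x ⁻¹ * x ⁻¹   ≈⟨ *-congʳ (⁻¹-inverseʳ x≉0) ⟩
    1# * x ⁻¹         ≈⟨ *-identityˡ _ ⟩
    x ⁻¹              ∎) (*-nonNeg 0≤x (0≤x² (x ⁻¹)))

  -- The axioms describe √ by its sign and its square, so identities such as `√-*` come from
  -- uniqueness of nonnegative roots. Here (x + y)(x - y) = 0, and x + y = 0 forces both to be 0.
  sqrt-unique : ∀ {x y} → 0# ≤ x → 0# ≤ y → x * x ≈ y * y → x ≈ y
  sqrt-unique {x} {y} 0≤x 0≤y x²≈y² with (x + y) ≈? 0#
  ... | yes x+y≈0 = trans (nonNeg-sum≈0 0≤x 0≤y x+y≈0)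
                      (sym (nonNeg-sum≈0 0≤y 0≤x (trans (+-comm y x) x+y≈0)))
  ... | no  x+y≉0 = x-y≈0⇒x≈y x y (*-cancelˡ-≈0 x+y≉0 (begin
    (x + y) * (x - y)              ≈⟨ x[y-z]≈xy-xz (x + y) x y ⟩
    (x + y) * x - (x + y) * y      ≈⟨ +-cong (distribʳ x x y) (-‿cong (distribʳ y x y)) ⟩
    (x * x + y * x) - (x * y + y * y)
      ≈⟨ +-congʳ (trans (+-congʳ x²≈y²) (trans (+-comm _ _) (+-congʳ (*-comm y x)))) ⟩
    (x * y + y * y) - (x * y + y * y) ≈⟨ -‿inverseʳ _ ⟩
    0#                             ∎))

  √-* : ∀ {x y} → 0# ≤ x → 0# ≤ y → √ (x * y) ≈ √ x * √ y
  √-* {x} {y} 0≤x 0≤y = sqrt-unique (√-nonNeg (*-nonNeg 0≤x 0≤y)) (*-nonNeg (√-nonNeg 0≤x) (√-nonNeg 0≤y)) (begin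
    √ (x * y) * √ (x * y)       ≈⟨ √-square (*-nonNeg 0≤x 0≤y) ⟩
    x * y                       ≈⟨ *-cong (√-square 0≤x) (√-square 0≤y) ⟨
    √ x * √ x * (√ y * √ y)     ≈⟨ solve 2 (λ a b → a :* a :* (b :* b) := a :* b :* (a :* b)) refl (√ x) (√ y) ⟩
    √ x * √ y * (√ x * √ y)     ∎)

  √≉0 : ∀ {x} → 0# ≤ x → ¬ (x ≈ 0#) → ¬ (√ x ≈ 0#)
  √≉0 0≤x x≉0 √x≈0 = x≉0 (trans (sym (√-square 0≤x)) (trans (*-congʳ √x≈0) (zeroˡ _)))

  -- Determinants

  Rows : ℕ → ℕ → Set c
  Rows m n = Fin m → Fin n → Carrier

  infix 4 _≋_
  _≋_ : ∀ {n} → Vector Carrier n → Vector Carrier n → Set ℓ₁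
  u ≋ v = ∀ i → u i ≈ v i

  record Linear {n} (f : Vector Carrier n → Carrier) : Set (c ⊔ ℓ₁) where
    field
      +-homo : ∀ u v → f (λ i → u i + v i) ≈ f u + f v
      *-homo : ∀ x u → f (λ i → x * u i) ≈ x * f u

  Congruent : ∀ {m n} → (Rows m n → Carrier) → Set (c ⊔ ℓ₁)
  Congruent F = ∀ {A B} → (∀ i → A i ≋ B i) → F A ≈ F B

  record HeadAlternating {m n} (F : Rows (suc m) n → Carrier) : Set (c ⊔ ℓ₁) where
    field
      linear : ∀ A → Linear (λ u → F (u ∷ A))
      vanish : ∀ u A i → A i ≋ u → F (u ∷ A) ≈ 0#

  -- Peels rows from the top, in step with the recursion of `det`. Equal rows both below the head
  -- are covered by the last component. Rows are functions compared pointwise, so congruence is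
  -- carried along explicitly.
  Alternating : ∀ m {n} → (Rows m n → Carrier) → Set (c ⊔ ℓ₁)
  Alternating zero    F = Congruent F
  Alternating (suc m) F = Congruent F × HeadAlternating F × (∀ u → Alternating m (F ∘ (u ∷_)))

  ∷-cong : ∀ {m n} {u v : Vector Carrier n} {A B : Rows m n} →
           u ≋ v → (∀ i → A i ≋ B i) → ∀ i → (u ∷ A) i ≋ (v ∷ B) i
  ∷-cong u≋v A≋B zero    = u≋v
  ∷-cong u≋v A≋B (suc i) = A≋B i

  ∷-η : ∀ {m n} (A : Rows (suc m) n) → ∀ i → A i ≋ (head A ∷ tail A) i
  ∷-η A zero    k = refl
  ∷-η A (suc i) k = refl

  alternating-resp : ∀ m {n} {F G : Rows m n → Carrier} → (∀ A → F A ≈ G A) →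
                     Alternating m F → Alternating m G
  alternating-resp zero    F≈G alt A≋B = trans (sym (F≈G _)) (trans (alt A≋B) (F≈G _))
  alternating-resp (suc m) F≈G (cong , hd , tl) =
    (λ A≋B → trans (sym (F≈G _)) (trans (cong A≋B) (F≈G _))) ,
    record
      { linear = λ A → let open Linear (linear A) in record
        { +-homo = λ u v → trans (sym (F≈G _)) (trans (+-homo u v) (+-cong (F≈G _) (F≈G _)))
        ; *-homo = λ x u → trans (sym (F≈G _)) (trans (*-homo x u) (*-congˡ (F≈G _)))
        }
      ; vanish = λ u A i eq → trans (sym (F≈G _)) (vanish u A i eq)
      } ,
    λ u → alternating-resp m (λ A → F≈G (u ∷ A)) (tl u)
    where open HeadAlternating hd

  -- A Laplace expansion is such a combination of minors, so with `alternating-∘` alternation of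
  -- `det` in the lower rows follows from the smaller size.
  alternating-∑ : ∀ m {n p} (x : Vector Carrier p) (F : Fin p → Rows m n → Carrier) →
                  (∀ j → Alternating m (F j)) → Alternating m (λ A → sum λ j → x j * F j A)
  alternating-∑ zero    x F alt A≋B = sum-cong-≋ λ j → *-congˡ (alt j A≋B)
  alternating-∑ (suc m) {n} {p} x F alt =
    (λ A≋B → sum-cong-≋ λ j → *-congˡ (proj₁ (alt j) A≋B)) ,
    record
      { linear = λ A → record
        { +-homo = λ u v → trans
            (sum-cong-≋ λ j → trans (*-congˡ (Linear.+-homo (linear j A) u v)) (distribˡ (x j) _ _))
            (∑-distrib-+ (λ j → x j * F j (u ∷ A)) (λ j → x j * F j (v ∷ A)))
        ; *-homo = λ y u → trans
            (sum-cong-≋ λ j → trans (*-congˡ (Linear.*-homo (linear j A) y u))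
              (solve 3 (λ a b c → a :* (b :* c) := b :* (a :* c)) refl (x j) y _))
            (sym (*-distribˡ-sum {p} y _))
        }
      ; vanish = λ u A i eq → sum-zero λ j → trans (*-congˡ (vanish j u A i eq)) (zeroʳ (x j))
      } ,
    λ u → alternating-∑ m x (λ j A → F j (u ∷ A)) (λ j → proj₂ (proj₂ (alt j)) u)
    where
    linear = λ j → HeadAlternating.linear (proj₁ (proj₂ (alt j)))
    vanish = λ j → HeadAlternating.vanish (proj₁ (proj₂ (alt j)))

  record IsLinearMap {p n} (L : Vector Carrier p → Vector Carrier n) : Set (c ⊔ ℓ₁) where
    field
      cong   : ∀ {u v} → u ≋ v → L u ≋ L v
      linear : ∀ i → Linear (λ u → L u i)

  -- Pullback along a linear map acting on each row. The maps needed are deletion of a column,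
  -- insertion of a zero column, and multiplication by a matrix on the right.
  alternating-∘ : ∀ m {p n} {L : Vector Carrier p → Vector Carrier n} → IsLinearMap L →
                  (F : Rows m n → Carrier) → Alternating m F → Alternating m (λ A → F (L ∘ A))
  alternating-∘ zero    lin F alt A≋B = alt (IsLinearMap.cong lin ∘ A≋B)
  alternating-∘ (suc m) {p} {n} {L} lin F (cong , hd , tl) =
    (λ A≋B → cong (L-cong ∘ A≋B)) ,
    record
      { linear = λ A → let open Linear (linear (L ∘ A)) in record
        { +-homo = λ u v → begin
            F (L ∘ ((λ i → u i + v i) ∷ A))        ≈⟨ cong (∘-∷ λ k → Linear.+-homo (L-linear k) u v) ⟩
            F ((λ k → L u k + L v k) ∷ (L ∘ A))    ≈⟨ +-homo (L u) (L v) ⟩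
            F (L u ∷ (L ∘ A)) + F (L v ∷ (L ∘ A))  ≈⟨ +-cong (cong (∘-∷ λ k → refl)) (cong (∘-∷ λ k → refl)) ⟨
            F (L ∘ (u ∷ A)) + F (L ∘ (v ∷ A))      ∎
        ; *-homo = λ x u → begin
            F (L ∘ ((λ i → x * u i) ∷ A))          ≈⟨ cong (∘-∷ λ k → Linear.*-homo (L-linear k) x u) ⟩
            F ((λ k → x * L u k) ∷ (L ∘ A))        ≈⟨ *-homo x (L u) ⟩
            x * F (L u ∷ (L ∘ A))                  ≈⟨ *-congˡ (cong (∘-∷ λ k → refl)) ⟨
            x * F (L ∘ (u ∷ A))                    ∎
        }
      ; vanish = λ u A i eq → trans (cong (∘-∷ λ k → refl)) (vanish (L u) (L ∘ A) i (L-cong eq))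
      } ,
    λ u → alternating-resp m (λ A → sym (cong (∘-∷ λ k → refl)))
            (alternating-∘ m lin (F ∘ (L u ∷_)) (tl (L u)))
    where
    open HeadAlternating hd
    open IsLinearMap lin renaming (cong to L-cong; linear to L-linear)
    ∘-∷ : ∀ {u} {w : Vector Carrier n} {A : Rows m p} →
          L u ≋ w → ∀ i → L ((u ∷ A) i) ≋ (w ∷ (L ∘ A)) i
    ∘-∷ eq zero    = eq
    ∘-∷ eq (suc i) = λ k → refl

  -- Expand F at (u + v, u + v). The hypotheses are listed singly rather than as `Alternating`
  -- because the swap is already used while `det` is being shown to be alternating.
  swap-by-polarization :
    ∀ {m n} {F : Rows (suc (suc m)) n → Carrier} →
    (∀ A → Linear (λ u → F (u ∷ A))) → (∀ u A → Linear (λ v → F (u ∷ (v ∷ A)))) →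
    (∀ u A → F (u ∷ (u ∷ A)) ≈ 0#) →
    ∀ u v A → F (u ∷ (v ∷ A)) ≈ - F (v ∷ (u ∷ A))
  swap-by-polarization {F = F} lin₁ lin₂ null u v A = +-inverseˡ-unique _ _ (begin
    uv + vu                ≈⟨ +-cong (+-identityˡ uv) (+-identityʳ vu) ⟨
    0# + uv + (vu + 0#)    ≈⟨ +-cong (+-congʳ (null u A)) (+-congˡ (null v A)) ⟨
    F (u ∷ (u ∷ A)) + uv + (vu + F (v ∷ (v ∷ A)))
      ≈⟨ +-cong (Linear.+-homo (lin₂ u A) u v) (Linear.+-homo (lin₂ v A) u v) ⟨
    F (u ∷ (u+v ∷ A)) + F (v ∷ (u+v ∷ A))
      ≈⟨ Linear.+-homo (lin₁ (u+v ∷ A)) u v ⟨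
    F (u+v ∷ (u+v ∷ A))    ≈⟨ null u+v A ⟩
    0#                     ∎)
    where
    uv  = F (u ∷ (v ∷ A))
    vu  = F (v ∷ (u ∷ A))
    u+v = λ i → u i + v i

  alternating-swap : ∀ m {n} {F : Rows (suc (suc m)) n → Carrier} →
                     Alternating (suc (suc m)) F →
                     ∀ u v A → F (u ∷ (v ∷ A)) ≈ - F (v ∷ (u ∷ A))
  alternating-swap m {F = F} (_ , hd , tl) = swap-by-polarization {F = F}
    (HeadAlternating.linear hd)
    (λ u → HeadAlternating.linear (proj₁ (proj₂ (tl u))))
    (λ u A → HeadAlternating.vanish hd u (u ∷ A) zero λ k → refl)

  sign : ∀ {n} → Fin n → Carrier
  sign j = (- 1#) ^ toℕ j

  -1*-1≈1 : - 1# * - 1# ≈ 1#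
  -1*-1≈1 = trans (-1*x≈-x (- 1#)) (-‿involutive 1#)

  -- The terms with j ≤ k cancel against those with j > k; peeling off the
  -- terms with j = 0 or k = 0 turns this into an induction.
  alternating-sum≈0 :
    ∀ m (h : Fin (suc m) → Fin m → Carrier) →
    (∀ a b → a ≤ᶠ b → h (inject₁ a) b ≈ h (suc b) a) →
    (sum λ j → sum λ k → sign j * sign k * h j k) ≈ 0#
  alternating-sum≈0 zero    h sym-h = +-identityʳ 0#
  alternating-sum≈0 (suc m) h sym-h = begin
    sum (λ k → sign {suc (suc m)} zero * sign k * h zero k) +
      sum (λ j → sign (suc j) * sign {suc m} zero * h (suc j) zero +
                 sum (λ k → sign (suc j) * sign (suc k) * h (suc j) (suc k)))
      ≈⟨ +-congˡ (∑-distrib-+ (λ j → sign (suc j) * sign {suc m} zero * h (suc j) zero)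
           (λ j → sum (λ k → sign (suc j) * sign (suc k) * h (suc j) (suc k)))) ⟩
    sum (λ k → sign {suc (suc m)} zero * sign k * h zero k) +
      (sum (λ j → sign (suc j) * sign {suc m} zero * h (suc j) zero) +
       sum (λ j → sum (λ k → sign (suc j) * sign (suc k) * h (suc j) (suc k))))
      ≈⟨ +-assoc _ _ _ ⟨
    sum (λ k → sign {suc (suc m)} zero * sign k * h zero k) +
      sum (λ j → sign (suc j) * sign {suc m} zero * h (suc j) zero) +
      sum (λ j → sum (λ k → sign (suc j) * sign (suc k) * h (suc j) (suc k)))
      ≈⟨ +-cong cancel (sum-cong-≋ λ j → sum-cong-≋ λ k → *-congʳ {h (suc j) (suc k)} (signs j k)) ⟩
    0# + sum (λ j → sum (λ k → sign j * sign k * h (suc j) (suc k)))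
      ≈⟨ +-identityˡ _ ⟩
    sum (λ j → sum (λ k → sign j * sign k * h (suc j) (suc k)))
      ≈⟨ alternating-sum≈0 m (λ j k → h (suc j) (suc k)) (λ a b a≤b → sym-h (suc a) (suc b) (s≤s a≤b)) ⟩
    0# ∎
    where
    signs : ∀ (j : Fin (suc m)) (k : Fin m) → sign (suc j) * sign (suc k) ≈ sign j * sign k
    signs j k = begin
      - 1# * sign j * (- 1# * sign k)
        ≈⟨ solve 3 (λ e a b → e :* a :* (e :* b) := e :* e :* (a :* b)) refl (- 1#) (sign j) (sign k) ⟩
      - 1# * - 1# * (sign j * sign k) ≈⟨ *-congʳ -1*-1≈1 ⟩
      1# * (sign j * sign k)          ≈⟨ *-identityˡ _ ⟩
      sign j * sign k                 ∎
    cancel : sum (λ k → sign {suc (suc m)} zero * sign k * h zero k) +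
             sum (λ j → sign (suc j) * sign {suc m} zero * h (suc j) zero) ≈ 0#
    cancel = trans (sym (∑-distrib-+ (λ k → 1# * sign k * h zero k)
                                 (λ k → - 1# * sign k * 1# * h (suc k) zero))) (sum-zero λ k → begin
      -- The term (0, k) meets the term (k + 1, 0): equal values of h, opposite signs.
      1# * sign k * h zero k + - 1# * sign k * 1# * h (suc k) zero
        ≈⟨ +-cong (*-congˡ (sym-h zero k z≤n)) (*-congʳ (*-identityʳ _)) ⟩
      1# * sign k * h (suc k) zero + - 1# * sign k * h (suc k) zero
        ≈⟨ solve 4 (λ o e a b → o :* a :* b :+ e :* a :* b := (o :+ e) :* (a :* b)) refl
             1# (- 1#) (sign k) (h (suc k) zero) ⟩
      (1# + - 1#) * (sign k * h (suc k) zero) ≈⟨ *-congʳ (-‿inverseʳ 1#) ⟩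
      0# * (sign k * h (suc k) zero)          ≈⟨ zeroˡ _ ⟩
      0#                                      ∎)

  minor : ∀ {m n} → Fin (suc n) → Rows m (suc n) → Rows m n
  minor j A i k = A i (punchIn j k)

  det-cong : ∀ m → Congruent (det {m})
  det-cong zero    A≋B = refl
  det-cong (suc m) A≋B = sum-cong-≋ λ j →
    *-congˡ {(- 1#) ^ toℕ j} (*-cong (A≋B zero j) (det-cong m λ i k → A≋B (suc i) (punchIn j k)))

  punchIn-linear : ∀ {n} (j : Fin (suc n)) →
                   IsLinearMap (λ (u : Vector Carrier (suc n)) → u ∘ punchIn j)
  punchIn-linear j = record
    { cong = λ u≋v → u≋v ∘ punchIn j
    ; linear = λ i → record { +-homo = λ u v → refl ; *-homo = λ x u → refl }
    }

  det-head-linear : ∀ m A → Linear (λ u → det {suc m} (u ∷ A))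
  det-head-linear m A = record
    { +-homo = λ u v → trans
        (sum-cong-≋ λ j → solve 4 (λ s a b d → s :* ((a :+ b) :* d) := s :* (a :* d) :+ s :* (b :* d))
          refl (sign j) (u j) (v j) (det (minor j A)))
        (∑-distrib-+ (λ j → sign j * (u j * det (minor j A))) (λ j → sign j * (v j * det (minor j A))))
    ; *-homo = λ x u → trans
        (sum-cong-≋ λ j → solve 4 (λ s a b d → s :* ((a :* b) :* d) := a :* (s :* (b :* d)))
          refl (sign j) x (u j) (det (minor j A)))
        (sym (*-distribˡ-sum {suc m} x (λ j → sign j * (u j * det (minor j A)))))
    }

  -- Expanding along both rows gives a sum over ordered pairs of distinct columns. Exchanging the
  -- two columns keeps the product of entries and minor but reverses the sign.
  det-equal-heads : ∀ m u A → det {suc (suc m)} (u ∷ (u ∷ A)) ≈ 0#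
  det-equal-heads m u A = begin
    sum (λ j → sign j * (u j * sum λ k → sign k * (u (punchIn j k) * D j k)))
      ≈⟨ sum-cong-≋ (λ j → trans (sym (*-assoc _ _ _)) (*-distribˡ-sum (sign j * u j) (λ k → sign k * (u (punchIn j k) * D j k)))) ⟩
    sum (λ j → sum λ k → sign j * u j * (sign k * (u (punchIn j k) * D j k)))
      ≈⟨ sum-cong-≋ (λ j → sum-cong-≋ λ k →
           solve 5 (λ a b c d e → a :* b :* (c :* (d :* e)) := a :* c :* (b :* (d :* e))) refl
             (sign j) (u j) (sign k) (u (punchIn j k)) (D j k)) ⟩
    sum (λ j → sum λ k → sign j * sign k * (u j * (u (punchIn j k) * D j k)))
      ≈⟨ alternating-sum≈0 (suc m) (λ j k → u j * (u (punchIn j k) * D j k)) symmetric ⟩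
    0# ∎
    where
    D : Fin (suc (suc m)) → Fin (suc m) → Carrier
    D j k = det (minor k (minor j A))
    symmetric : ∀ a b → a ≤ᶠ b → u (inject₁ a) * (u (punchIn (inject₁ a) b) * D (inject₁ a) b) ≈
                                u (suc b) * (u (punchIn (suc b) a) * D (suc b) a)
    symmetric a b a≤b = begin
      u (inject₁ a) * (u (punchIn (inject₁ a) b) * D (inject₁ a) b)
        ≈⟨ *-congˡ (*-cong (reflexive (≡.cong u (punchIn-inject₁-≤ a b a≤b)))
             (det-cong m λ i l → reflexive (≡.cong (A i) (punchIn-punchIn a b a≤b l)))) ⟩
      u (inject₁ a) * (u (suc b) * D (suc b) a)
        ≈⟨ solve 3 (λ x y z → x :* (y :* z) := y :* (x :* z)) refl _ _ _ ⟩
      u (suc b) * (u (inject₁ a) * D (suc b) a)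
        ≈⟨ *-congˡ (*-congʳ (reflexive (≡.cong u (punchIn-suc-≤ a b a≤b)))) ⟨
      u (suc b) * (u (punchIn (suc b) a) * D (suc b) a) ∎

  -- If the head recurs in the next row, `det-equal-heads` applies. If it recurs further down,
  -- swapping the first two rows puts both copies into the rows below a fixed head, where the form
  -- is alternating by induction.
  det-alternating : ∀ m → Alternating m (det {m})
  det-alternating zero    = det-cong zero
  det-alternating (suc m) =
    det-cong (suc m) , record { linear = det-head-linear m ; vanish = vanish m tl } , tl
    where
    tl : ∀ u → Alternating m (λ A → det {suc m} (u ∷ A))
    tl u = alternating-resp m
      (λ A → sum-cong-≋ λ j → *-assoc (sign j) (u j) (det (minor j A)))
      (alternating-∑ m (λ j → sign j * u j) (λ j A → det (minor j A))
        (λ j → alternating-∘ m (punchIn-linear j) (det {m}) (det-alternating m)))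
    vanish : ∀ m → (∀ u → Alternating m (λ A → det {suc m} (u ∷ A))) →
             ∀ u A i → A i ≋ u → det {suc m} (u ∷ A) ≈ 0#
    vanish (suc m) tl u A zero    eq = trans
      (det-cong (suc (suc m)) (∷-cong {u = u} (λ k → refl) λ i k → trans (∷-η A i k) (∷-cong {A = tail A} eq (λ i k → refl) i k)))
      (det-equal-heads m u (tail A))
    vanish (suc m) tl u A (suc i) eq = begin
      det (u ∷ A)
        ≈⟨ det-cong (suc (suc m)) (∷-cong {u = u} (λ k → refl) (∷-η A)) ⟩
      det (u ∷ (head A ∷ tail A))
        ≈⟨ swap-by-polarization {F = det {suc (suc m)}} (det-head-linear (suc m))
             (λ u → HeadAlternating.linear (proj₁ (proj₂ (tl u)))) (det-equal-heads m) u (head A) (tail A) ⟩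
      - det (head A ∷ (u ∷ tail A))
        ≈⟨ -‿cong (HeadAlternating.vanish (proj₁ (proj₂ (tl (head A)))) u (tail A) i eq) ⟩
      - 0#
        ≈⟨ -0#≈0# ⟩
      0# ∎

  linear-expansion : ∀ {n} {f : Vector Carrier n → Carrier} → (∀ {u v} → u ≋ v → f u ≈ f v) →
                     Linear f → ∀ u → f u ≈ sum (λ j → u j * f (identity j))
  linear-expansion {n} {f} cong lin u = begin
    f u                                     ≈⟨ cong (λ i → sym (sum-identityʳ i u)) ⟩
    f (λ i → sum λ j → u j * identity j i)  ≈⟨ f-sum u identity ⟩
    sum (λ j → u j * f (identity j))        ∎
    where
    open Linear lin
    f-sum : ∀ {p} (x : Vector Carrier p) (w : Fin p → Vector Carrier n) →
            f (λ i → sum λ j → x j * w j i) ≈ sum (λ j → x j * f (w j))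
    f-sum {zero}  x w = begin
      f (λ i → 0#)      ≈⟨ cong (λ i → sym (zeroˡ 0#)) ⟩
      f (λ i → 0# * 0#) ≈⟨ *-homo 0# (λ i → 0#) ⟩
      0# * f (λ i → 0#) ≈⟨ zeroˡ _ ⟩
      0#                ∎
    f-sum {suc p} x w = begin
      f (λ i → x zero * w zero i + sum λ j → x (suc j) * w (suc j) i)
        ≈⟨ +-homo _ _ ⟩
      f (λ i → x zero * w zero i) + f (λ i → sum λ j → x (suc j) * w (suc j) i)
        ≈⟨ +-cong (*-homo (x zero) (w zero)) (f-sum (tail x) (tail w)) ⟩
      x zero * f (w zero) + sum (λ j → x (suc j) * f (w (suc j))) ∎

  -- Row by row, the added part contributes a multiple of a value of F with e among the rows. With e
  -- a unit vector, this clears a column.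
  alternating-add : ∀ m {n} {F : Rows m n → Carrier} → Alternating m F →
                    ∀ e → (∀ A i → A i ≋ e → F A ≈ 0#) →
                    ∀ A (x : Vector Carrier m) → F (λ i k → A i k + x i * e k) ≈ F A
  alternating-add zero    alt e null A x = alt (λ ())
  alternating-add (suc m) {F = F} (cong , hd , tl) e null A x = begin
    F (λ i k → A i k + x i * e k)
      ≈⟨ cong (∷-η (λ i k → A i k + x i * e k)) ⟩
    F ((λ k → A zero k + x zero * e k) ∷ A+xe)
      ≈⟨ +-homo (A zero) (λ k → x zero * e k) ⟩
    F (A zero ∷ A+xe) + F ((λ k → x zero * e k) ∷ A+xe)
      ≈⟨ +-congˡ (trans (*-homo (x zero) e) (*-congˡ (null (e ∷ A+xe) zero (λ k → refl)))) ⟩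
    F (A zero ∷ A+xe) + x zero * 0#
      ≈⟨ trans (+-congˡ (zeroʳ _)) (+-identityʳ _) ⟩
    F (A zero ∷ A+xe)
      ≈⟨ alternating-add m (tl (A zero)) e (λ B i eq → null (A zero ∷ B) (suc i) eq) (tail A) (tail x) ⟩
    F (A zero ∷ tail A)
      ≈⟨ cong (∷-η A) ⟨
    F A ∎
    where
    A+xe : Rows m _
    A+xe i k = A (suc i) k + x (suc i) * e k
    open Linear (HeadAlternating.linear hd A+xe)

  -- Row j reaches the front after `toℕ j` swaps of neighbours, each contributing a factor -1.
  alternating-move : ∀ m {n} {F : Rows (suc m) n → Carrier} → Alternating (suc m) F →
                     ∀ (w : Rows (suc m) n) j → F (w j ∷ (w ∘ punchIn j)) ≈ sign j * F w
  alternating-move m       (cong , _ , _) w zero    =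
    trans (cong λ i k → sym (∷-η w i k)) (sym (*-identityˡ _))
  alternating-move (suc m) {F = F} alt@(cong , hd , tl) w (suc j) = begin
    F (w (suc j) ∷ (w ∘ punchIn (suc j)))
      ≈⟨ cong (∷-cong {u = w (suc j)} (λ k → refl) (∷-η (w ∘ punchIn (suc j)))) ⟩
    F (w (suc j) ∷ (w zero ∷ (w ∘ suc ∘ punchIn j)))
      ≈⟨ alternating-swap m alt _ _ _ ⟩
    - F (w zero ∷ (w (suc j) ∷ (w ∘ suc ∘ punchIn j)))
      ≈⟨ -‿cong (alternating-move m (tl (w zero)) (w ∘ suc) j) ⟩
    - (sign j * F (w zero ∷ (w ∘ suc)))
      ≈⟨ -‿cong (*-congˡ (cong λ i k → sym (∷-η w i k))) ⟩
    - (sign j * F w)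
      ≈⟨ -1*x≈-x _ ⟨
    - 1# * (sign j * F w)
      ≈⟨ *-assoc _ _ _ ⟨
    sign (suc j) * F w ∎

  -- A linear right inverse of deleting column j; it turns a form on large matrices into one on
  -- minors.
  insertZero : ∀ {n} → Fin (suc n) → Vector Carrier n → Vector Carrier (suc n)
  insertZero j u = insertAt u j 0#

  insertZero-at : ∀ {n} (j : Fin (suc n)) u → insertZero j u j ≈ 0#
  insertZero-at j u = reflexive (insertAt-lookup u j 0#)

  insertZero-punchIn : ∀ {n} (j : Fin (suc n)) u k → insertZero j u (punchIn j k) ≈ u k
  insertZero-punchIn j u k = reflexive (insertAt-punchIn u j 0# k)

  insertZero-≋ : ∀ {n} (j : Fin (suc n)) {u : Vector Carrier n} {v : Vector Carrier (suc n)} →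
                 v j ≈ 0# → (∀ k → v (punchIn j k) ≈ u k) → insertZero j u ≋ v
  insertZero-≋ j {u} {v} vj≈0 v≈u = punchIn-elim (λ i → insertZero j u i ≈ v i) j
    (trans (insertZero-at j u) (sym vj≈0))
    (λ k → trans (insertZero-punchIn j u k) (sym (v≈u k)))

  insertZero-linear : ∀ {n} (j : Fin (suc n)) → IsLinearMap (insertZero j)
  insertZero-linear j = record
    { cong   = λ {u} {v} u≋v → insertZero-≋ j (insertZero-at j v)
        (λ k → trans (insertZero-punchIn j v k) (sym (u≋v k)))
    ; linear = λ i → record
      { +-homo = λ u v → insertZero-≋ j
          (trans (+-cong (insertZero-at j u) (insertZero-at j v)) (+-identityˡ 0#))
          (λ k → +-cong (insertZero-punchIn j u k) (insertZero-punchIn j v k)) i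
      ; *-homo = λ x u → insertZero-≋ j
          (trans (*-congˡ (insertZero-at j u)) (zeroʳ x))
          (λ k → *-congˡ (insertZero-punchIn j u k)) i
      }
    }

  insertZero-identity : ∀ {n} (j : Fin (suc n)) i → insertZero j (identity i) ≋ identity (punchIn j i)
  insertZero-identity j i = insertZero-≋ j
    (reflexive (identity-no {i = punchIn j i} {j} (punchInᵢ≢i j i)))
    (λ k → reflexive (identity-cong {i = punchIn j i} {punchIn j k} {i} {k}
      (punchIn-injective j i k) (≡.cong (punchIn j))))

  -- F (e_j ∷ A) does not depend on column j of A, hence is an alternating
  -- form in the minor of A, which is where the Laplace expansion comes from.
  alternating-unique : ∀ m (F : Rows m m → Carrier) → Alternating m F →
                       ∀ A → F A ≈ det A * F identity
  alternating-unique zero    F alt A = trans (alt λ ()) (sym (*-identityˡ _))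
  alternating-unique (suc m) F alt@(cong , hd , tl) A = begin
    F A
      ≈⟨ cong (∷-η A) ⟩
    F (head A ∷ tail A)
      ≈⟨ linear-expansion (λ u≋v → cong (∷-cong u≋v λ i k → refl)) (HeadAlternating.linear hd (tail A)) (head A) ⟩
    sum (λ j → A zero j * F (identity j ∷ tail A))
      ≈⟨ sum-cong-≋ (λ j → *-congˡ {A zero j} (cofactor j)) ⟩
    sum (λ j → A zero j * (det (minor j (tail A)) * (sign j * F identity)))
      ≈⟨ sum-cong-≋ (λ j → solve 4 (λ a d s f → a :* (d :* (s :* f)) := s :* (a :* d) :* f) refl
           (A zero j) (det (minor j (tail A))) (sign j) (F identity)) ⟩
    sum (λ j → sign j * (A zero j * det (minor j (tail A))) * F identity)
      ≈⟨ *-distribʳ-sum (F identity) (λ j → sign j * (A zero j * det (minor j (tail A)))) ⟨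
    det A * F identity ∎
    where
    cofactor : ∀ j → F (identity j ∷ tail A) ≈ det (minor j (tail A)) * (sign j * F identity)
    cofactor j = begin
      F (identity j ∷ tail A)
        -- Each row is split into its part off column j and a multiple of e_j; the multiple is then
        -- dropped, since e_j is already the first row.
        ≈⟨ cong (∷-cong {u = identity j} (λ k → refl) λ i →
             punchIn-elim (λ k → tail A i k ≈ insertZero j (minor j (tail A) i) k + tail A i j * identity j k) j
               (sym (trans (+-cong (insertZero-at j _)
                             (trans (*-congˡ (reflexive (identity-yes {i = j} ≡.refl))) (*-identityʳ _)))
                      (+-identityˡ _)))
               (λ k → sym (trans (+-cong (insertZero-punchIn j _ k)
                                   (trans (*-congˡ (reflexive (identity-no (punchInᵢ≢i j k ∘ ≡.sym)))) (zeroʳ _)))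
                            (+-identityʳ _)))) ⟩
      F (identity j ∷ λ i k → insertZero j (minor j (tail A) i) k + tail A i j * identity j k)
        ≈⟨ alternating-add m (tl (identity j)) (identity j) (HeadAlternating.vanish hd (identity j))
             (insertZero j ∘ minor j (tail A)) (λ i → tail A i j) ⟩
      F (identity j ∷ (insertZero j ∘ minor j (tail A)))
        ≈⟨ alternating-unique m (λ B → F (identity j ∷ (insertZero j ∘ B)))
             (alternating-∘ m (insertZero-linear j) (F ∘ (identity j ∷_)) (tl (identity j))) (minor j (tail A)) ⟩
      det (minor j (tail A)) * F (identity j ∷ (insertZero j ∘ identity))
        ≈⟨ *-congˡ (cong (∷-cong {u = identity j} (λ k → refl) (insertZero-identity j))) ⟩
      det (minor j (tail A)) * F (identity j ∷ (identity ∘ punchIn j))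
        ≈⟨ *-congˡ (alternating-move m alt identity j) ⟩
      det (minor j (tail A)) * (sign j * F identity) ∎

  -- Determinants of products, block matrices and multiples

  infixl 7 _⊗_
  _⊗_ : ∀ {m n p} → Rows m n → Rows n p → Rows m p
  (A ⊗ B) i k = sum λ j → A i j * B j k

  -- For fixed B, `det (A ⊗ B)` is an alternating form in the rows of A, hence a multiple of
  -- `det A`; the factor is its value at the identity.
  det-⊗ : ∀ m (A B : Matrix m) → det (A ⊗ B) ≈ det A * det B
  det-⊗ m A B = trans
    (alternating-unique m (λ A → det (A ⊗ B))
      (alternating-∘ m linear det (det-alternating m)) A)
    (*-congˡ (det-cong m λ i k → sum-identity i (λ j → B j k)))
    where
    linear : IsLinearMap (λ u k → sum λ j → u j * B j k)
    linear = record
      { cong   = λ u≋v k → sum-cong-≋ λ j → *-congʳ (u≋v j)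
      ; linear = λ k → record
        { +-homo = λ u v → trans (sum-cong-≋ λ j → distribʳ (B j k) (u j) (v j))
            (∑-distrib-+ (λ j → u j * B j k) (λ j → v j * B j k))
        ; *-homo = λ x u → trans (sum-cong-≋ λ j → *-assoc x (u j) (B j k))
            (sym (*-distribˡ-sum x (λ j → u j * B j k)))
        }
      }

  sum-↑ : ∀ m {n} (f : Vector Carrier (m ℕ+ n)) →
          sum f ≈ sum (λ i → f (i ↑ˡ n)) + sum (λ j → f (m ↑ʳ j))
  sum-↑ zero    f = sym (+-identityˡ _)
  sum-↑ (suc m) f = trans (+-congˡ (sum-↑ m (tail f))) (sym (+-assoc _ _ _))

  -- In the expansion along the first row only the left columns contribute, and each of their minors
  -- is again block triangular with the same lower right block.
  det-block : ∀ m {n} (A : Matrix (m ℕ+ n)) → (∀ i j → A (i ↑ˡ n) (m ↑ʳ j) ≈ 0#) →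
              det A ≈ det (λ i j → A (i ↑ˡ n) (j ↑ˡ n)) * det (λ i j → A (m ↑ʳ i) (m ↑ʳ j))
  det-block zero    {n} A A≈0 = sym (*-identityˡ _)
  det-block (suc m) {n} A A≈0 = begin
    sum (λ j → sign j * (A zero j * det (minor j (tail A))))
      ≈⟨ sum-↑ (suc m) (λ j → sign j * (A zero j * det (minor j (tail A)))) ⟩
    sum (λ j → sign (j ↑ˡ n) * (A zero (j ↑ˡ n) * det (minor (j ↑ˡ n) (tail A)))) +
      sum (λ j → sign (suc m ↑ʳ j) * (A zero (suc m ↑ʳ j) * det (minor (suc m ↑ʳ j) (tail A))))
      ≈⟨ +-cong (sum-cong-≋ step)
           (sum-zero λ j → trans (*-congˡ {sign (suc m ↑ʳ j)} (trans (*-congʳ (A≈0 zero j)) (zeroˡ _))) (zeroʳ _)) ⟩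
    sum (λ j → sign j * (A zero (j ↑ˡ n) * det (minor j (tail ul))) * det lr) + 0#
      ≈⟨ +-identityʳ _ ⟩
    sum (λ j → sign j * (A zero (j ↑ˡ n) * det (minor j (tail ul))) * det lr)
      ≈⟨ *-distribʳ-sum (det lr) (λ j → sign j * (A zero (j ↑ˡ n) * det (minor j (tail ul)))) ⟨
    det ul * det lr ∎
    where
    ul = λ i j → A (i ↑ˡ n) (j ↑ˡ n)
    lr = λ i j → A (suc m ↑ʳ i) (suc m ↑ʳ j)
    step : ∀ j → sign (j ↑ˡ n) * (A zero (j ↑ˡ n) * det (minor (j ↑ˡ n) (tail A))) ≈
                 sign j * (A zero (j ↑ˡ n) * det (minor j (tail ul))) * det lr
    step j = begin
      sign (j ↑ˡ n) * (A zero (j ↑ˡ n) * det (minor (j ↑ˡ n) (tail A)))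
        ≈⟨ *-cong (reflexive (≡.cong ((- 1#) ^_) (toℕ-↑ˡ j n))) (*-congˡ (begin
             det (minor (j ↑ˡ n) (tail A))
               ≈⟨ det-block m (minor (j ↑ˡ n) (tail A))
                    (λ i k → trans (reflexive (≡.cong (tail A (i ↑ˡ n)) (punchIn-↑ˡ-↑ʳ j k))) (A≈0 (suc i) k)) ⟩
             det (λ i k → tail A (i ↑ˡ n) (punchIn (j ↑ˡ n) (k ↑ˡ n))) *
               det (λ i k → tail A (m ↑ʳ i) (punchIn (j ↑ˡ n) (m ↑ʳ k)))
               ≈⟨ *-cong (det-cong m λ i k → reflexive (≡.cong (tail A (i ↑ˡ n)) (punchIn-↑ˡ-↑ˡ n j k)))
                         (det-cong n λ i k → reflexive (≡.cong (tail A (m ↑ʳ i)) (punchIn-↑ˡ-↑ʳ j k))) ⟩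
             det (minor j (tail ul)) * det lr ∎)) ⟩
      sign j * (A zero (j ↑ˡ n) * (det (minor j (tail ul)) * det lr))
        ≈⟨ solve 4 (λ s a b d → s :* (a :* (b :* d)) := s :* (a :* b) :* d) refl
             (sign j) (A zero (j ↑ˡ n)) (det (minor j (tail ul))) (det lr) ⟩
      sign j * (A zero (j ↑ˡ n) * det (minor j (tail ul))) * det lr ∎

  det-identity : ∀ m → det (identity {m}) ≈ 1#
  det-identity zero    = refl
  det-identity (suc m) = begin
    1# * (1# * det (minor zero (tail (identity {suc m})))) +
      sum (λ j → sign (suc j) * (0# * det (minor (suc j) (tail (identity {suc m})))))
      ≈⟨ +-cong (trans (*-identityˡ _) (*-identityˡ _))
           (sum-zero λ j → trans (*-congˡ {sign (suc j)} (zeroˡ (det (minor (suc j) (tail (identity {suc m}))))))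
                                (zeroʳ (sign (suc j)))) ⟩
    det (minor zero (tail (identity {suc m}))) + 0#
      ≈⟨ +-identityʳ _ ⟩
    det (minor zero (tail (identity {suc m})))
      ≈⟨ det-cong m (λ i k → reflexive (identity-suc i k)) ⟩
    det (identity {m})
      ≈⟨ det-identity m ⟩
    1# ∎

  det-scale : ∀ m x (A : Matrix m) → det (λ i j → x * A i j) ≈ x ^ m * det A
  det-scale zero    x A = sym (*-identityʳ 1#)
  det-scale (suc m) x A = begin
    sum (λ j → sign j * (x * A zero j * det (λ i k → x * minor j (tail A) i k)))
      ≈⟨ sum-cong-≋ (λ j → *-congˡ {sign j} (*-congˡ {x * A zero j} (det-scale m x (minor j (tail A))))) ⟩
    sum (λ j → sign j * (x * A zero j * (x ^ m * det (minor j (tail A)))))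
      ≈⟨ sum-cong-≋ (λ j → solve 5 (λ s a b d e → s :* (a :* b :* (d :* e)) := a :* d :* (s :* (b :* e))) refl
           (sign j) x (A zero j) (x ^ m) (det (minor j (tail A)))) ⟩
    sum (λ j → x * x ^ m * (sign j * (A zero j * det (minor j (tail A)))))
      ≈⟨ *-distribˡ-sum (x * x ^ m) (λ j → sign j * (A zero j * det (minor j (tail A)))) ⟨
    x ^ suc m * det A ∎

  -- Characteristic polynomials

  sum-distrib-- : ∀ {n} (f g : Vector Carrier n) → sum (λ i → f i - g i) ≈ sum f - sum g
  sum-distrib-- f g = begin
    sum (λ i → f i - g i)             ≈⟨ ∑-distrib-+ f (λ i → - g i) ⟩
    sum f + sum (λ i → - g i)         ≈⟨ +-congˡ (sum-cong-≋ λ i → -1*x≈-x (g i)) ⟨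
    sum f + sum (λ i → - 1# * g i)    ≈⟨ +-congˡ (*-distribˡ-sum (- 1#) g) ⟨
    sum f + - 1# * sum g              ≈⟨ +-congˡ (-1*x≈-x _) ⟩
    sum f - sum g                     ∎

  ⊗-assoc : ∀ {m n p q} (A : Rows m n) (B : Rows n p) (C : Rows p q) i k →
            ((A ⊗ B) ⊗ C) i k ≈ (A ⊗ (B ⊗ C)) i k
  ⊗-assoc A B C i k = begin
    sum (λ l → sum (λ j → A i j * B j l) * C l k)
      ≈⟨ sum-cong-≋ (λ l → *-distribʳ-sum (C l k) (λ j → A i j * B j l)) ⟩
    sum (λ l → sum λ j → A i j * B j l * C l k)
      ≈⟨ ∑-comm (λ l j → A i j * B j l * C l k) ⟩
    sum (λ j → sum λ l → A i j * B j l * C l k)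
      ≈⟨ sum-cong-≋ (λ j → sum-cong-≋ λ l → *-assoc (A i j) (B j l) (C l k)) ⟩
    sum (λ j → sum λ l → A i j * (B j l * C l k))
      ≈⟨ sum-cong-≋ (λ j → *-distribˡ-sum (A i j) (λ l → B j l * C l k)) ⟨
    sum (λ j → A i j * sum λ l → B j l * C l k) ∎

  -- Q (t - A) T = t - Q A T because Q T = 1, and det Q * det T = 1 for the same reason.
  charPoly-similar : ∀ {m} (A Q T : Matrix m) → (∀ i k → (Q ⊗ T) i k ≈ identity i k) →
                     ∀ t → charPoly A t ≈ charPoly (Q ⊗ A ⊗ T) t
  charPoly-similar {m} A Q T QT≈1 t = begin
    det Aₜ
      ≈⟨ *-identityˡ _ ⟨
    1# * det Aₜ
      ≈⟨ *-congʳ (trans (det-cong m QT≈1) (det-identity m)) ⟨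
    det (Q ⊗ T) * det Aₜ
      ≈⟨ *-congʳ (det-⊗ m Q T) ⟩
    det Q * det T * det Aₜ
      ≈⟨ solve 3 (λ a b c → a :* b :* c := a :* c :* b) refl (det Q) (det T) (det Aₜ) ⟩
    det Q * det Aₜ * det T
      ≈⟨ trans (det-⊗ m (Q ⊗ Aₜ) T) (*-congʳ (det-⊗ m Q Aₜ)) ⟨
    det (Q ⊗ Aₜ ⊗ T)
      ≈⟨ det-cong m entry ⟩
    charPoly (Q ⊗ A ⊗ T) t ∎
    where
    Aₜ : Matrix m
    Aₜ i j = t * identity i j - A i j
    Q⊗Aₜ : ∀ i l → (Q ⊗ Aₜ) i l ≈ t * Q i l - (Q ⊗ A) i l
    Q⊗Aₜ i l = begin
      sum (λ j → Q i j * (t * identity j l - A j l))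
        ≈⟨ sum-cong-≋ (λ j → x[y-z]≈xy-xz (Q i j) (t * identity j l) (A j l)) ⟩
      sum (λ j → Q i j * (t * identity j l) - Q i j * A j l)
        ≈⟨ sum-distrib-- (λ j → Q i j * (t * identity j l)) (λ j → Q i j * A j l) ⟩
      sum (λ j → Q i j * (t * identity j l)) - (Q ⊗ A) i l
        ≈⟨ +-congʳ (trans (sum-cong-≋ λ j → trans (sym (*-assoc _ _ _)) (*-congʳ (*-comm (Q i j) t)))
                     (sum-identityʳ l (λ j → t * Q i j))) ⟩
      t * Q i l - (Q ⊗ A) i l ∎
    entry : ∀ i k → (Q ⊗ Aₜ ⊗ T) i k ≈ t * identity i k - (Q ⊗ A ⊗ T) i k
    entry i k = begin
      sum (λ l → (Q ⊗ Aₜ) i l * T l k)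
        ≈⟨ sum-cong-≋ (λ l → trans (*-congʳ (Q⊗Aₜ i l)) ([y-z]x≈yx-zx (T l k) (t * Q i l) ((Q ⊗ A) i l))) ⟩
      sum (λ l → t * Q i l * T l k - (Q ⊗ A) i l * T l k)
        ≈⟨ sum-distrib-- (λ l → t * Q i l * T l k) (λ l → (Q ⊗ A) i l * T l k) ⟩
      sum (λ l → t * Q i l * T l k) - (Q ⊗ A ⊗ T) i k
        ≈⟨ +-congʳ (trans (sum-cong-≋ λ l → *-assoc t (Q i l) (T l k))
             (trans (sym (*-distribˡ-sum t (λ l → Q i l * T l k))) (*-congˡ (QT≈1 i k)))) ⟩
      t * identity i k - (Q ⊗ A ⊗ T) i k ∎

  charPoly-block : ∀ m {r} (M : Matrix (m ℕ+ r)) (B : Matrix m) →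
                   (∀ i j → M (i ↑ˡ r) (j ↑ˡ r) ≈ B i j) → (∀ i j → M (i ↑ˡ r) (m ↑ʳ j) ≈ 0#) →
                   ∀ t → charPoly M t ≈ charPoly B t * charPoly (λ i j → M (m ↑ʳ i) (m ↑ʳ j)) t
  charPoly-block m {r} M B ul ur t = trans
    (det-block m (λ i j → t * identity i j - M i j)
      (λ i j → trans (+-cong (trans (*-congˡ (reflexive (identity-no (↑ˡ≢↑ʳ i j)))) (zeroʳ t))
                             (trans (-‿cong (ur i j)) -0#≈0#))
                     (+-identityˡ 0#)))
    (*-cong
      (det-cong m λ i j → +-cong (*-congˡ (reflexive
        (identity-cong {i = i ↑ˡ r} {j ↑ˡ r} {i} {j} (↑ˡ-injective r i j) (≡.cong (_↑ˡ r))))) (-‿cong (ul i j)))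
      (det-cong r λ i j → +-congʳ (*-congˡ (reflexive
        (identity-cong {i = m ↑ʳ i} {m ↑ʳ j} {i} {j} (↑ʳ-injective m i j) (≡.cong (m ↑ʳ_)))))))

  -- Completing the rows of P by unit vectors outside the range of σ gives an
  -- invertible Q for which Q A Q⁻¹ is block triangular with diagonal block B.
  charPoly-intertwined :
    ∀ {m s} (A : Matrix s) (B : Matrix m) (P : Rows m s) → (∀ i k → (P ⊗ A) i k ≈ (B ⊗ P) i k) →
    (σ : Fin m → Fin s) → Injective _≡_ _≡_ σ →
    (d e : Vector Carrier m) → (∀ i → d i * e i ≈ 1#) → (∀ i j → P i (σ j) ≈ identity i j * d j) →
    ∃₂ λ r (C : Matrix r) → ∀ t → charPoly A t ≈ charPoly B t * charPoly C t
  charPoly-intertwined {m} {s} A B P PA≈BP σ σ-inj d e de≈1 Pσ with extend-to-permutation σ σ-inj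
  ... | r , π , π≡σ with ↔⇒≡ π
  -- π forces s = m + r. Matching on this equality makes Q and T square: rows of Q are numbered by
  -- blocks, while its columns keep the numbering of A.
  ...   | ≡.refl = r , _ , λ t → trans (charPoly-similar A Q T QT≈1 t) (charPoly-block m (Q ⊗ A ⊗ T) B ul ur t)
    where
    π-inj : Injective _≡_ _≡_ (π ⟨$⟩ʳ_)
    π-inj = Injection.injective (↔⇒↣ π)
    τ : Fin r → Fin s
    τ j = π ⟨$⟩ʳ (m ↑ʳ j)
    τ≢σ : ∀ j i → τ j ≢ σ i
    τ≢σ j i eq = ↑ˡ≢↑ʳ i j (π-inj (≡.trans (π≡σ i) (≡.sym eq)))

    Q T : Matrix (m ℕ+ r)
    Q = P ++ λ j → identity (τ j)
    Qˡ : ∀ i a → Q (i ↑ˡ r) a ≡ P i a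
    Qˡ i a = ≡.cong (λ u → u a) (lookup-++ˡ P (λ j → identity (τ j)) i)
    Qʳ : ∀ j a → Q (m ↑ʳ j) a ≡ identity (τ j) a
    Qʳ j a = ≡.cong (λ u → u a) (lookup-++ʳ P (λ j → identity (τ j)) j)

    -- With the columns sorted by π, Q is the block matrix (D X; 0 1), where D is the diagonal
    -- matrix of d and X has entries P i (τ j). T is its inverse (D⁻¹ -D⁻¹X; 0 1), with rows in the
    -- original numbering.
    Tˡ : Rows (m ℕ+ r) m
    Tˡ a i = identity a (σ i) * e i
    Tʳ : Rows (m ℕ+ r) r
    Tʳ a j = identity a (τ j) - sum λ i → identity a (σ i) * (e i * P i (τ j))
    T a = Tˡ a ++ Tʳ a

    ∑-Tˡ : ∀ (u : Vector Carrier (m ℕ+ r)) i → sum (λ a → u a * T a (i ↑ˡ r)) ≈ u (σ i) * e i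
    ∑-Tˡ u i = begin
      sum (λ a → u a * T a (i ↑ˡ r))
        ≈⟨ sum-cong-≋ (λ a → *-congˡ (reflexive (lookup-++ˡ (Tˡ a) (Tʳ a) i))) ⟩
      sum (λ a → u a * (identity a (σ i) * e i))
        ≈⟨ sum-cong-≋ (λ a → solve 3 (λ x y z → x :* (y :* z) := x :* z :* y) refl (u a) (identity a (σ i)) (e i)) ⟩
      sum (λ a → u a * e i * identity a (σ i))
        ≈⟨ sum-identityʳ (σ i) (λ a → u a * e i) ⟩
      u (σ i) * e i ∎

    ∑-Tʳ : ∀ (u : Vector Carrier (m ℕ+ r)) j →
           sum (λ a → u a * T a (m ↑ʳ j)) ≈ u (τ j) - sum λ i → u (σ i) * (e i * P i (τ j))
    ∑-Tʳ u j = begin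
      sum (λ a → u a * T a (m ↑ʳ j))
        ≈⟨ sum-cong-≋ (λ a → *-congˡ (reflexive (lookup-++ʳ (Tˡ a) (Tʳ a) j))) ⟩
      sum (λ a → u a * Tʳ a j)
        ≈⟨ sum-cong-≋ (λ a → x[y-z]≈xy-xz (u a) (identity a (τ j)) _) ⟩
      sum (λ a → u a * identity a (τ j) - u a * sum λ i → identity a (σ i) * x i)
        ≈⟨ sum-distrib-- (λ a → u a * identity a (τ j)) (λ a → u a * sum λ i → identity a (σ i) * x i) ⟩
      sum (λ a → u a * identity a (τ j)) - sum (λ a → u a * sum λ i → identity a (σ i) * x i)
        ≈⟨ +-cong (sum-identityʳ (τ j) u) (-‿cong (begin
             sum (λ a → u a * sum λ i → identity a (σ i) * x i)
               ≈⟨ sum-cong-≋ (λ a → *-distribˡ-sum (u a) (λ i → identity a (σ i) * x i)) ⟩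
             sum (λ a → sum λ i → u a * (identity a (σ i) * x i))
               ≈⟨ ∑-comm (λ a i → u a * (identity a (σ i) * x i)) ⟩
             sum (λ i → sum λ a → u a * (identity a (σ i) * x i))
               ≈⟨ sum-cong-≋ (λ i → trans
                    (sum-cong-≋ λ a → solve 3 (λ x y z → x :* (y :* z) := x :* z :* y) refl
                      (u a) (identity a (σ i)) (x i))
                    (sum-identityʳ (σ i) (λ a → u a * x i))) ⟩
             sum (λ i → u (σ i) * x i) ∎)) ⟩
      u (τ j) - sum (λ i → u (σ i) * x i) ∎
      where x = λ i → e i * P i (τ j)

    QT≈1 : ∀ k l → (Q ⊗ T) k l ≈ identity k l
    QT≈1 = ↑-elim m _
      (λ i → ↑-elim m _ (λ k → upper-left i k) (λ j → upper-right i j))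
      (λ j → ↑-elim m _ (λ k → lower-left j k) (λ l → lower-right j l))
      where
      upper : ∀ i k → (Q ⊗ T) (i ↑ˡ r) k ≈ sum (λ a → P i a * T a k)
      upper i k = sum-cong-≋ λ a → *-congʳ (reflexive (Qˡ i a))
      lower : ∀ j k → (Q ⊗ T) (m ↑ʳ j) k ≈ sum (λ a → identity (τ j) a * T a k)
      lower j k = sum-cong-≋ λ a → *-congʳ (reflexive (Qʳ j a))
      upper-left : ∀ i k → (Q ⊗ T) (i ↑ˡ r) (k ↑ˡ r) ≈ identity (i ↑ˡ r) (k ↑ˡ r)
      upper-left i k = begin
        (Q ⊗ T) (i ↑ˡ r) (k ↑ˡ r)       ≈⟨ upper i (k ↑ˡ r) ⟩
        sum (λ a → P i a * T a (k ↑ˡ r)) ≈⟨ ∑-Tˡ (P i) k ⟩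
        P i (σ k) * e k                  ≈⟨ *-congʳ (Pσ i k) ⟩
        identity i k * d k * e k         ≈⟨ trans (*-assoc _ _ _) (*-congˡ (de≈1 k)) ⟩
        identity i k * 1#                ≈⟨ *-identityʳ _ ⟩
        identity i k                     ≡⟨ identity-cong {i = i} {k} {i ↑ˡ r} {k ↑ˡ r} (≡.cong (_↑ˡ r)) (↑ˡ-injective r i k) ⟩
        identity (i ↑ˡ r) (k ↑ˡ r)       ∎
      upper-right : ∀ i j → (Q ⊗ T) (i ↑ˡ r) (m ↑ʳ j) ≈ identity (i ↑ˡ r) (m ↑ʳ j)
      upper-right i j = begin
        (Q ⊗ T) (i ↑ˡ r) (m ↑ʳ j)        ≈⟨ upper i (m ↑ʳ j) ⟩
        sum (λ a → P i a * T a (m ↑ʳ j)) ≈⟨ ∑-Tʳ (P i) j ⟩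
        P i (τ j) - sum (λ k → P i (σ k) * (e k * P k (τ j)))
          ≈⟨ +-congˡ (-‿cong (trans
               (sum-cong-≋ λ k → trans (*-congʳ (Pσ i k))
                 (solve 4 (λ a b c f → a :* b :* (c :* f) := a :* (b :* c :* f)) refl
                   (identity i k) (d k) (e k) (P k (τ j))))
               (sum-identity i (λ k → d k * e k * P k (τ j))))) ⟩
        P i (τ j) - d i * e i * P i (τ j)
          ≈⟨ +-congˡ (-‿cong (trans (*-congʳ (de≈1 i)) (*-identityˡ _))) ⟩
        P i (τ j) - P i (τ j)            ≈⟨ -‿inverseʳ _ ⟩
        0#                               ≡⟨ identity-no (↑ˡ≢↑ʳ i j) ⟨
        identity (i ↑ˡ r) (m ↑ʳ j)       ∎
      lower-left : ∀ j k → (Q ⊗ T) (m ↑ʳ j) (k ↑ˡ r) ≈ identity (m ↑ʳ j) (k ↑ˡ r)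
      lower-left j k = begin
        (Q ⊗ T) (m ↑ʳ j) (k ↑ˡ r)        ≈⟨ trans (lower j (k ↑ˡ r)) (∑-Tˡ (identity (τ j)) k) ⟩
        identity (τ j) (σ k) * e k       ≈⟨ trans (*-congʳ (reflexive (identity-no (τ≢σ j k)))) (zeroˡ _) ⟩
        0#                               ≡⟨ identity-no (↑ˡ≢↑ʳ k j ∘ ≡.sym) ⟨
        identity (m ↑ʳ j) (k ↑ˡ r)       ∎
      lower-right : ∀ j l → (Q ⊗ T) (m ↑ʳ j) (m ↑ʳ l) ≈ identity (m ↑ʳ j) (m ↑ʳ l)
      lower-right j l = begin
        (Q ⊗ T) (m ↑ʳ j) (m ↑ʳ l)        ≈⟨ trans (lower j (m ↑ʳ l)) (∑-Tʳ (identity (τ j)) l) ⟩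
        identity (τ j) (τ l) - sum (λ i → identity (τ j) (σ i) * (e i * P i (τ l)))
          ≈⟨ +-congˡ (trans (-‿cong (sum-zero λ i → trans (*-congʳ (reflexive (identity-no (τ≢σ j i)))) (zeroˡ _)))
               -0#≈0#) ⟩
        identity (τ j) (τ l) + 0#        ≈⟨ +-identityʳ _ ⟩
        identity (τ j) (τ l)
          ≡⟨ identity-cong {i = τ j} {τ l} {m ↑ʳ j} {m ↑ʳ l} π-inj (≡.cong (π ⟨$⟩ʳ_)) ⟩
        identity (m ↑ʳ j) (m ↑ʳ l)       ∎

    -- The upper rows of Q A T are P A T = B P T, and P T is the upper part of Q T = 1, so they are
    -- (B 0).
    QAT : ∀ i k → (Q ⊗ A ⊗ T) (i ↑ˡ r) k ≈ sum (λ j → B i j * identity (j ↑ˡ r) k)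
    QAT i k = begin
      sum (λ l → (Q ⊗ A) (i ↑ˡ r) l * T l k)
        ≈⟨ sum-cong-≋ (λ l → *-congʳ (trans (sum-cong-≋ λ a → *-congʳ (reflexive (Qˡ i a))) (PA≈BP i l))) ⟩
      sum (λ l → (B ⊗ P) i l * T l k)
        ≈⟨ ⊗-assoc B P T i k ⟩
      sum (λ j → B i j * sum λ l → P j l * T l k)
        ≈⟨ sum-cong-≋ (λ j → *-congˡ (trans (sum-cong-≋ λ a → *-congʳ (reflexive (≡.sym (Qˡ j a)))) (QT≈1 (j ↑ˡ r) k))) ⟩
      sum (λ j → B i j * identity (j ↑ˡ r) k) ∎
    ul : ∀ i j → (Q ⊗ A ⊗ T) (i ↑ˡ r) (j ↑ˡ r) ≈ B i j
    ul i j = trans (QAT i (j ↑ˡ r)) (trans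
      (sum-cong-≋ λ k → *-congˡ (reflexive
        (identity-cong {i = k ↑ˡ r} {j ↑ˡ r} {k} {j} (↑ˡ-injective r k j) (≡.cong (_↑ˡ r)))))
      (sum-identityʳ j (B i)))
    ur : ∀ i j → (Q ⊗ A ⊗ T) (i ↑ˡ r) (m ↑ʳ j) ≈ 0#
    ur i j = trans (QAT i (m ↑ʳ j)) (sum-zero λ k → trans
      (*-congˡ (reflexive (identity-no (↑ˡ≢↑ʳ k j)))) (zeroʳ (B i k)))

  -- Polynomial functions

  -- Horner form with d coefficients.
  Polynomial : ℕ → (Carrier → Carrier) → Set (c ⊔ ℓ₁)
  Polynomial zero    f = ∀ t → f t ≈ 0#
  Polynomial (suc d) f = ∃₂ λ a g → Polynomial d g × (∀ t → f t ≈ a + t * g t)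

  IsPolynomial : (Carrier → Carrier) → Set (c ⊔ ℓ₁)
  IsPolynomial f = ∃ λ d → Polynomial d f

  polynomial-resp : ∀ d {f g} → (∀ t → f t ≈ g t) → Polynomial d f → Polynomial d g
  polynomial-resp zero    f≈g f≈0               t = trans (sym (f≈g t)) (f≈0 t)
  polynomial-resp (suc d) f≈g (a , h , ph , eq)   = a , h , ph , λ t → trans (sym (f≈g t)) (eq t)

  polynomial-+ : ∀ d e {f g} → Polynomial d f → Polynomial e g → Polynomial (d ℕ⊔ e) (λ t → f t + g t)
  polynomial-+ zero    e       f≈0 pg = polynomial-resp e (λ t → sym (trans (+-congʳ (f≈0 t)) (+-identityˡ _))) pg
  polynomial-+ (suc d) zero    pf g≈0 = polynomial-resp (suc d) (λ t → sym (trans (+-congˡ (g≈0 t)) (+-identityʳ _))) pf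
  polynomial-+ (suc d) (suc e) (a , f , pf , f≈) (b , g , pg , g≈) =
    a + b , (λ t → f t + g t) , polynomial-+ d e pf pg , λ t → trans (+-cong (f≈ t) (g≈ t))
      (solve 5 (λ a b f g t → a :+ t :* f :+ (b :+ t :* g) := a :+ b :+ t :* (f :+ g)) refl
        a b (f t) (g t) t)

  polynomial-*ˡ : ∀ d {f} x → Polynomial d f → Polynomial d (λ t → x * f t)
  polynomial-*ˡ zero    x f≈0 t = trans (*-congˡ (f≈0 t)) (zeroʳ x)
  polynomial-*ˡ (suc d) x (a , f , pf , f≈) = x * a , (λ t → x * f t) , polynomial-*ˡ d x pf , λ t →
    trans (*-congˡ (f≈ t)) (solve 4 (λ x a f t → x :* (a :+ t :* f) := x :* a :+ t :* (x :* f)) refl x a (f t) t)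

  polynomial-shift : ∀ d {f} → Polynomial d f → Polynomial (suc d) (λ t → t * f t)
  polynomial-shift d {f} pf = 0# , f , pf , λ t → sym (+-identityˡ _)

  isPolynomial-resp : ∀ {f g} → (∀ t → f t ≈ g t) → IsPolynomial f → IsPolynomial g
  isPolynomial-resp f≈g (d , p) = d , polynomial-resp d f≈g p

  isPolynomial-const : ∀ x → IsPolynomial (λ _ → x)
  isPolynomial-const x = 1 , x , (λ _ → 0#) , (λ _ → refl) ,
    λ t → sym (trans (+-congˡ (zeroʳ t)) (+-identityʳ x))

  isPolynomial-id : IsPolynomial (λ t → t)
  isPolynomial-id = isPolynomial-resp (λ t → *-identityʳ t)
    (_ , polynomial-shift 1 (proj₂ (isPolynomial-const 1#)))

  isPolynomial-+ : ∀ {f g} → IsPolynomial f → IsPolynomial g → IsPolynomial (λ t → f t + g t)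
  isPolynomial-+ (d , p) (e , q) = d ℕ⊔ e , polynomial-+ d e p q

  isPolynomial-* : ∀ {f g} → IsPolynomial f → IsPolynomial g → IsPolynomial (λ t → f t * g t)
  isPolynomial-* {f} {g} (zero  , f≈0) q =
    zero , λ t → trans (*-congʳ (f≈0 t)) (zeroˡ _)
  isPolynomial-* {f} {g} (suc d , a , h , ph , f≈) q@(e , pg) = isPolynomial-resp
    (λ t → sym (trans (*-congʳ (f≈ t))
      (solve 4 (λ a t h g → (a :+ t :* h) :* g := a :* g :+ t :* (h :* g)) refl a t (h t) (g t))))
    (isPolynomial-+ (e , polynomial-*ˡ e a pg)
      (let d′ , p = isPolynomial-* (d , ph) q in suc d′ , polynomial-shift d′ p))

  isPolynomial-- : ∀ {f g} → IsPolynomial f → IsPolynomial g → IsPolynomial (λ t → f t - g t)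
  isPolynomial-- {f} {g} p q = isPolynomial-resp (λ t → +-congˡ (-1*x≈-x (g t)))
    (isPolynomial-+ p (isPolynomial-* (isPolynomial-const (- 1#)) q))

  isPolynomial-sum : ∀ {n} (f : Fin n → Carrier → Carrier) → (∀ i → IsPolynomial (f i)) →
                     IsPolynomial (λ t → sum λ i → f i t)
  isPolynomial-sum {zero}  f p = isPolynomial-const 0#
  isPolynomial-sum {suc n} f p = isPolynomial-+ (p zero) (isPolynomial-sum (f ∘ suc) (p ∘ suc))

  isPolynomial-product : ∀ {n} (f : Fin n → Carrier → Carrier) → (∀ i → IsPolynomial (f i)) →
                         IsPolynomial (λ t → product λ i → f i t)
  isPolynomial-product {zero}  f p = isPolynomial-const 1#
  isPolynomial-product {suc n} f p = isPolynomial-* (p zero) (isPolynomial-product (f ∘ suc) (p ∘ suc))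

  isPolynomial-det : ∀ m (M : Carrier → Matrix m) → (∀ i j → IsPolynomial (λ t → M t i j)) →
                     IsPolynomial (λ t → det (M t))
  isPolynomial-det zero    M p = isPolynomial-const 1#
  isPolynomial-det (suc m) M p = isPolynomial-sum
    (λ j t → sign j * (M t zero j * det (minor j (tail (M t))))) λ j →
    isPolynomial-* (isPolynomial-const (sign j))
      (isPolynomial-* (p zero j) (isPolynomial-det m (λ t → minor j (tail (M t))) λ i k → p (suc i) (punchIn j k)))

  isPolynomial-linear : ∀ a → IsPolynomial (λ t → t - a)
  isPolynomial-linear a = isPolynomial-- isPolynomial-id (isPolynomial-const a)

  isPolynomial-charPoly : ∀ {m} (M : Matrix m) → IsPolynomial (charPoly M)
  isPolynomial-charPoly {m} M = isPolynomial-det m (λ t i j → t * identity i j - M i j) λ i j →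
    isPolynomial-- (isPolynomial-* isPolynomial-id (isPolynomial-const _)) (isPolynomial-const _)

  -- Linear factors and roots with multiplicity

  -- Synthetic division in Horner form: the remainder is f b, and the quotient has one coefficient
  -- fewer, which drives the recursion of `eventually-zero`.
  divide-at : ∀ d {f} → Polynomial (suc d) f → ∀ b →
              ∃ λ h → Polynomial d h × (∀ t → f t ≈ f b + (t - b) * h t)
  divide-at zero    {f} (a , g , g≈0 , f≈) b = (λ _ → 0#) , (λ _ → refl) , λ t → begin
    f t                    ≈⟨ const t ⟩
    a                      ≈⟨ const b ⟨
    f b                    ≈⟨ +-identityʳ _ ⟨
    f b + 0#               ≈⟨ +-congˡ (zeroʳ _) ⟨
    f b + (t - b) * 0#     ∎
    where
    const : ∀ t → f t ≈ a
    const t = trans (f≈ t) (trans (+-congˡ (trans (*-congˡ (g≈0 t)) (zeroʳ t))) (+-identityʳ a))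
  divide-at (suc d) {f} (a , g , pg , f≈) b =
    let h , ph , g≈ = divide-at d pg b in
    (λ t → g b + t * h t) , (g b , h , ph , λ t → refl) , λ t → begin
      f t                                    ≈⟨ f≈ t ⟩
      a + t * g t                            ≈⟨ +-congˡ (*-cong (sym (x-y+y≈x b t)) (g≈ t)) ⟩
      a + (t - b + b) * (g b + (t - b) * h t)
        ≈⟨ solve 5 (λ a u b g h → a :+ (u :+ b) :* (g :+ u :* h) := a :+ b :* g :+ u :* (g :+ (u :+ b) :* h)) refl
             a (t - b) b (g b) (h t) ⟩
      a + b * g b + (t - b) * (g b + (t - b + b) * h t)
        ≈⟨ +-cong (sym (f≈ b)) (*-congˡ (+-congˡ (*-congʳ (x-y+y≈x b t)))) ⟩
      f b + (t - b) * (g b + t * h t)        ∎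

  1+b≤t⇒t-b≉0 : ∀ {b t} → 1# + b ≤ t → ¬ (t - b ≈ 0#)
  1+b≤t⇒t-b≉0 {b} {t} 1+b≤t t-b≈0 = 0≉1 (antisym 0≤1
    (≤-respˡ-≈ (trans (+-assoc 1# b (- b)) (trans (+-congˡ (-‿inverseʳ b)) (+-identityʳ 1#)))
      (≤-respʳ-≈ t-b≈0 (+-monoˡ-≤ (- b) 1+b≤t))))

  b≤1+b : ∀ b → b ≤ 1# + b
  b≤1+b b = ≤-respˡ-≈ (+-identityˡ b) (+-monoˡ-≤ b 0≤1)

  -- The root b splits off a factor t - b, which is nonzero from 1 + b on, so the quotient vanishes
  -- there too. A half line always has room for this next root.
  eventually-zero : ∀ d {f} → Polynomial d f → ∀ b → (∀ t → b ≤ t → f t ≈ 0#) → ∀ t → f t ≈ 0#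
  eventually-zero zero    f≈0 b null = f≈0
  eventually-zero (suc d) {f} pf b null t =
    let h , ph , f≈ = divide-at d pf b
        f≈′ = λ t → trans (f≈ t) (trans (+-congʳ (null b ≤-refl)) (+-identityˡ _))
        h≈0 = eventually-zero d ph (1# + b) λ t 1+b≤t →
          *-cancelˡ-≈0 (1+b≤t⇒t-b≉0 1+b≤t) (trans (sym (f≈′ t)) (null t (≤-trans (b≤1+b b) 1+b≤t)))
    in trans (f≈′ t) (trans (*-congˡ (h≈0 t)) (zeroʳ _))

  -- Pointwise cancellation fails at t = b. It is carried out for t at least 1 + b, and the
  -- polynomial f - g then vanishes everywhere.
  cancel-linear : ∀ {f g} → IsPolynomial f → IsPolynomial g → ∀ b →
                  (∀ t → (t - b) * f t ≈ (t - b) * g t) → ∀ t → f t ≈ g t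
  cancel-linear {f} {g} p q b eq t =
    let d , r = isPolynomial-- p q in
    x-y≈0⇒x≈y (f t) (g t) (eventually-zero d r (1# + b)
      (λ t 1+b≤t → x≈y⇒x-y≈0 (*-cancelˡ-≈ (1+b≤t⇒t-b≉0 1+b≤t) (eq t))) t)

  product≈0 : ∀ {n} (f : Vector Carrier n) → product f ≈ 0# → ∃ λ i → f i ≈ 0#
  product≈0 {zero}  f eq = contradiction (sym eq) 0≉1
  product≈0 {suc n} f eq with f zero ≈? 0#
  ... | yes f₀≈0 = zero , f₀≈0
  ... | no  f₀≉0 = let i , fᵢ≈0 = product≈0 (f ∘ suc) (*-cancelˡ-≈0 f₀≉0 eq) in suc i , fᵢ≈0

  -- The first entry of v is a root of the right side, so it equals some w i. Cancelling the common
  -- factor leaves the same statement for the tail of v and w without entry i, with the same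
  -- cofactor g. Deleting i at each stage is what keeps the positions distinct.
  subvector : ∀ {m n} (v : Vector Carrier m) (w : Vector Carrier n) {g} → IsPolynomial g →
              (∀ t → product (λ i → t - w i) ≈ product (λ i → t - v i) * g t) → IsSubvector v w
  subvector {zero}  v w p eq = (λ ()) , (λ { {()} }) , λ ()
  subvector {suc m} {n} v w {g} p eq = go n w eq (product≈0 (λ i → v zero - w i) (begin
    product (λ i → v zero - w i)  ≈⟨ eq (v zero) ⟩
    (v zero - v zero) * product (λ i → v zero - v (suc i)) * g (v zero)
      ≈⟨ *-congʳ (trans (*-congʳ (-‿inverseʳ _)) (zeroˡ _)) ⟩
    0# * g (v zero)               ≈⟨ zeroˡ _ ⟩
    0#                            ∎))
    where
    go : ∀ n (w : Vector Carrier n) →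
         (∀ t → product (λ i → t - w i) ≈ product (λ i → t - v i) * g t) →
         (∃ λ i → v zero - w i ≈ 0#) → IsSubvector v w
    go (suc n) w eq (i , v₀-wᵢ≈0) =
      let ι , ι-inj , wι≈v = subvector (tail v) (w ∘ punchIn i) p (cancel-linear
            (isPolynomial-product (λ j t → t - w (punchIn i j)) λ j → isPolynomial-linear _)
            (isPolynomial-* (isPolynomial-product (λ j t → t - v (suc j)) λ j → isPolynomial-linear _) p)
            (v zero) λ t → begin
              (t - v zero) * product (λ j → t - w (punchIn i j))
                ≈⟨ *-congʳ (+-congˡ (-‿cong v₀≈wᵢ)) ⟩
              (t - w i) * product (λ j → t - w (punchIn i j))
                ≈⟨ Product.sum-remove {i = i} (λ j → t - w j) ⟨
              product (λ j → t - w j)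
                ≈⟨ eq t ⟩
              (t - v zero) * product (λ j → t - v (suc j)) * g t
                ≈⟨ *-assoc _ _ _ ⟩
              (t - v zero) * (product (λ j → t - v (suc j)) * g t) ∎)
      in (i ∷ (punchIn i ∘ ι)) ,
         (λ { {zero}  {zero}  eq → ≡.refl
            ; {zero}  {suc k} eq → contradiction (≡.sym eq) (punchInᵢ≢i i (ι k))
            ; {suc j} {zero}  eq → contradiction eq (punchInᵢ≢i i (ι j))
            ; {suc j} {suc k} eq → ≡.cong suc (ι-inj (punchIn-injective i (ι j) (ι k) eq)) }) ,
         λ { zero → sym v₀≈wᵢ ; (suc j) → wι≈v j }
      where
      v₀≈wᵢ : v zero ≈ w i
      v₀≈wᵢ = x-y≈0⇒x≈y (v zero) (w i) v₀-wᵢ≈0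

  product-scale : ∀ {m} x (f : Vector Carrier m) → product (λ i → x * f i) ≈ x ^ m * product f
  product-scale {zero}  x f = sym (*-identityˡ 1#)
  product-scale {suc m} x f = trans (*-congˡ (product-scale x (tail f)))
    (solve 4 (λ a b c d → a :* b :* (c :* d) := a :* c :* (b :* d)) refl x (head f) (x ^ m) (product (tail f)))

  -- Substitute t = x u: both the determinant and the product give up a factor x ^ m, leaving the
  -- given identity at u.
  scaled-eigenvalues : ∀ {m} (M : Matrix m) (v : Vector Carrier m) x → ¬ (x ≈ 0#) →
    IsEigenvalueVector M v → IsEigenvalueVector (λ i j → x * M i j) (λ i → x * v i)
  scaled-eigenvalues {m} M v x x≉0 eigen t = begin
    charPoly (λ i j → x * M i j) t
      ≈⟨ det-cong m (λ i j → trans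
           (+-congʳ (trans (*-congʳ t≈xu) (*-assoc x u (identity i j))))
           (sym (x[y-z]≈xy-xz x (u * identity i j) (M i j)))) ⟩
    det (λ i j → x * (u * identity i j - M i j))
      ≈⟨ det-scale m x (λ i j → u * identity i j - M i j) ⟩
    x ^ m * charPoly M u
      ≈⟨ *-congˡ (eigen u) ⟩
    x ^ m * product (λ i → u - v i)
      ≈⟨ product-scale x (λ i → u - v i) ⟨
    product (λ i → x * (u - v i))
      ≈⟨ Product.sum-cong-≋ (λ i → trans (x[y-z]≈xy-xz x u (v i)) (+-congʳ (sym t≈xu))) ⟩
    product (λ i → t - x * v i) ∎
    where
    u = x ⁻¹ * t
    t≈xu : t ≈ x * u
    t≈xu = sym (trans (sym (*-assoc x (x ⁻¹) t)) (trans (*-congʳ (⁻¹-inverseʳ x≉0)) (*-identityˡ t)))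

  -- Association schemes

  -- The bridge from counts in ℕ to sums of 0/1 indicators; afterwards counting means rearranging
  -- sums in the field.
  count-sum : ∀ {n p} {A : Set} {P : A → Set p} (P? : Decidable P) (g : Fin n → A) (f : Vector Carrier n) →
              (∀ i → P (g i) → f i ≈ 1#) → (∀ i → ¬ P (g i) → f i ≈ 0#) →
              count P? (tabulate g) · 1# ≈ sum f
  count-sum {zero}  P? g f f≈1 f≈0 = refl
  count-sum {suc n} P? g f f≈1 f≈0 with P? (g zero)
  ... | yes P₀ = +-cong (sym (f≈1 zero P₀)) (count-sum P? (g ∘ suc) (tail f) (f≈1 ∘ suc) (f≈0 ∘ suc))
  ... | no ¬P₀ = trans (count-sum P? (g ∘ suc) (tail f) (f≈1 ∘ suc) (f≈0 ∘ suc))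
                   (trans (sym (+-identityˡ _)) (+-congʳ (sym (f≈0 zero ¬P₀))))

  count-identity : ∀ {n m} (h : Fin n → Fin m) a →
                   count (λ z → h z ≟ a) (allFin n) · 1# ≈ sum (λ z → identity (h z) a)
  count-identity h a = count-sum (λ z → h z ≟ a) id _
    (λ z eq → reflexive (identity-yes {i = h z} {a} eq)) (λ z neq → reflexive (identity-no {i = h z} {a} neq))

  sum-fibres₂ : ∀ {m n} (h : Fin n → Fin m) (f : Fin m → Fin m → Carrier) (g : Fin n → Fin n → Carrier) →
    sum (λ p → sum λ q → f (h p) (h q) * g p q) ≈
    sum (λ p′ → sum λ q′ → f p′ q′ *
      sum λ p → identity (h p) p′ * sum λ q → identity (h q) q′ * g p q)
  sum-fibres₂ {m} {n} h f g = begin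
    sum (λ p → sum λ q → f (h p) (h q) * g p q)
      ≈⟨ sum-cong-≋ (λ p → sum-fibres h (f (h p)) (g p)) ⟩
    sum (λ p → sum λ q′ → f (h p) q′ * G p q′)
      ≈⟨ ∑-comm (λ p q′ → f (h p) q′ * G p q′) ⟩
    sum (λ q′ → sum λ p → f (h p) q′ * G p q′)
      ≈⟨ sum-cong-≋ (λ q′ → sum-fibres h (λ p′ → f p′ q′) (λ p → G p q′)) ⟩
    sum (λ q′ → sum λ p′ → f p′ q′ * sum λ p → identity (h p) p′ * G p q′)
      ≈⟨ ∑-comm (λ q′ p′ → f p′ q′ * sum λ p → identity (h p) p′ * G p q′) ⟩
    sum (λ p′ → sum λ q′ → f p′ q′ * sum λ p → identity (h p) p′ * G p q′) ∎
    where
    G : Fin n → Fin m → Carrier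
    G p q′ = sum λ q → identity (h q) q′ * g p q

  -- Structure constants, valencies and the normalisation of one scheme

  module Scheme {n s} (𝒳 : CoherentConfiguration n s) (scheme : IsAssociationScheme 𝒳) where
    open CoherentConfiguration 𝒳 public

    i₀ : Fin s
    i₀ = proj₁ scheme

    colour≡i₀⇒≡ : ∀ {x y} → colour x y ≡ i₀ → x ≡ y
    colour≡i₀⇒≡ {x} {y} = Equivalence.to (proj₂ scheme x y)

    ≡⇒colour≡i₀ : ∀ {x y} → x ≡ y → colour x y ≡ i₀
    ≡⇒colour≡i₀ {x} {y} = Equivalence.from (proj₂ scheme x y)

    w : Fin s → Carrier
    w a = ‖ a ‖ · 1#

    D : Fin s → Fin s → Fin s → Carrier
    D p q a = ∇ p q a · 1#

    colour-source-target : ∀ a → colour (source a) (target a) ≡ a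
    colour-source-target a = proj₂ (proj₂ (nonempty a))

    -- The entry at (x , y) of the product of the adjacency matrices of p and q. Regularity moves
    -- the count from (x , y) to the pair chosen in `∇`.
    path-sum : ∀ p q x y → sum (λ z → identity (colour x z) p * identity (colour z y) q) ≈ D p q (colour x y)
    path-sum p q x y = begin
      sum (λ z → identity (colour x z) p * identity (colour z y) q)
        ≈⟨ count-sum (λ z → (colour x z ≟ p) ×-dec (colour z y ≟ q)) id _
             (λ z (eq₁ , eq₂) → trans (*-cong (reflexive (identity-yes {i = colour x z} eq₁))
                                              (reflexive (identity-yes {i = colour z y} eq₂))) (*-identityˡ 1#))
             (λ z neq → zero-unless z (colour x z ≟ p) neq) ⟨
      paths p q x y · 1#
        ≡⟨ ≡.cong (_· 1#) (regular p q (colour x y) ≡.refl (colour-source-target (colour x y))) ⟩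
      D p q (colour x y) ∎
      where
      zero-unless : ∀ z → Dec (colour x z ≡ p) → ¬ (colour x z ≡ p × colour z y ≡ q) →
                    identity (colour x z) p * identity (colour z y) q ≈ 0#
      zero-unless z (yes eq) neq = trans
        (*-congˡ (reflexive (identity-no {i = colour z y} (λ eq′ → neq (eq , eq′))))) (zeroʳ _)
      zero-unless z (no neq) _   = trans (*-congʳ (reflexive (identity-no {i = colour x z} neq))) (zeroˡ _)

    -- The entry at (x , y) of a product of two general elements of the adjacency algebra, with
    -- coefficients f and g.
    weighted-path-sum : ∀ (f g : Vector Carrier s) x y →
      sum (λ z → f (colour x z) * g (colour z y)) ≈
      sum (λ p → f p * sum λ q → g q * D p q (colour x y))
    weighted-path-sum f g x y = begin
      sum (λ z → f (colour x z) * g (colour z y))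
        ≈⟨ sum-fibres (colour x) f (λ z → g (colour z y)) ⟩
      sum (λ p → f p * sum λ z → identity (colour x z) p * g (colour z y))
        ≈⟨ sum-cong-≋ (λ p → *-congˡ (begin
             sum (λ z → identity (colour x z) p * g (colour z y))
               ≈⟨ sum-cong-≋ {n} (λ z → *-comm _ _) ⟩
             sum (λ z → g (colour z y) * identity (colour x z) p)
               ≈⟨ sum-fibres (λ z → colour z y) g (λ z → identity (colour x z) p) ⟩
             sum (λ q → g q * sum λ z → identity (colour z y) q * identity (colour x z) p)
               ≈⟨ sum-cong-≋ (λ q → *-congˡ (trans (sum-cong-≋ {n} λ z → *-comm _ _) (path-sum p q x y))) ⟩
             sum (λ q → g q * D p q (colour x y)) ∎)) ⟩
      sum (λ p → f p * sum λ q → g q * D p q (colour x y)) ∎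

    -- An a-neighbour y of x is the same as a closed path from x to y along a and back along its
    -- converse. All pairs (x , x) share the colour `i₀`, so regularity removes the dependence on x.
    valency : ∀ x a → sum (λ y → identity (colour x y) a) ≈ w a
    valency x a = trans (closed-paths x) (trans (sym (closed-paths (source a)))
      (sym (count-identity (colour (source a)) a)))
      where
      a* = proj₁ (converse a)
      closed-paths : ∀ x → sum (λ y → identity (colour x y) a) ≈ D a a* i₀
      closed-paths x = begin
        sum (λ y → identity (colour x y) a)
          ≈⟨ sum-cong-≋ {n} (λ y → *-identityʳ _) ⟨
        sum (λ y → identity (colour x y) a * 1#)
          ≈⟨ sum-cong-≋ {n} (λ y → identity-subst (colour x y) a λ eq →
               reflexive (≡.sym (identity-yes {i = colour y x} (Equivalence.from (proj₂ (converse a) x y) eq)))) ⟩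
        sum (λ y → identity (colour x y) a * identity (colour y x) a*)
          ≈⟨ path-sum a a* x x ⟩
        D a a* (colour x x)
          ≡⟨ ≡.cong (D a a*) (≡⇒colour≡i₀ ≡.refl) ⟩
        D a a* i₀ ∎

    w≉0 : ∀ a → ¬ (w a ≈ 0#)
    w≉0 a = ·1≉0 ‖ a ‖ (m<n⇒n≢0
      (count-positive (λ y → colour (source a) y ≟ a) id (target a) (colour-source-target a)))

    -- The valency at x equals the one at `source a`, which is nonzero. This supplies the premise of
    -- admissibility at every point.
    neighbour : ∀ x a → ∃ λ y → colour x y ≡ a
    neighbour x a with any? (λ y → colour x y ≟ a)
    ... | yes found = found
    ... | no  none  = contradiction
      (trans (sym (valency x a)) (sum-zero λ y → reflexive (identity-no {i = colour x y} λ eq → none (y , eq))))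
      (w≉0 a)

    r : Fin s → Carrier
    r a = √ (w a)

    I : Fin s → Fin s → Carrier
    I p q = (w p * w q) ⁻¹

    -- What is left of `O` once r a * r b is taken out. No √ remains, so a morphism acts on it by
    -- counting.
    N : Matrix s
    N a b = sum λ p → sum λ q → I p q * (D p q a * D p q b)

    r² : ∀ a → r a * r a ≈ w a
    r² a = √-square (·1-nonNeg ‖ a ‖)

    r≉0 : ∀ a → ¬ (r a ≈ 0#)
    r≉0 a = √≉0 (·1-nonNeg ‖ a ‖) (w≉0 a)

    w*w≉0 : ∀ p q → ¬ (w p * w q ≈ 0#)
    w*w≉0 p q = *-≉0 (w≉0 p) (w≉0 q)

    I-nonNeg : ∀ p q → 0# ≤ I p q
    I-nonNeg p q = ⁻¹-nonNeg (*-nonNeg (·1-nonNeg ‖ p ‖) (·1-nonNeg ‖ q ‖)) (w*w≉0 p q)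

    -- Each normalising root splits as r a * √ (I p q), and √ (I p q) occurs twice in every summand.
    O-factor : ∀ a b → O 𝒳 a b ≈ r a * r b * N a b
    O-factor a b = begin
      sum (λ p → sum λ q → ∇̇ 𝒳 p q a * ∇̇ 𝒳 p q b)
        ≈⟨ sum-cong-≋ (λ p → sum-cong-≋ λ q → begin
             √ (w a * I p q) * D p q a * (√ (w b * I p q) * D p q b)
               ≈⟨ *-cong (*-congʳ (√-* (·1-nonNeg ‖ a ‖) (I-nonNeg p q))) (*-congʳ (√-* (·1-nonNeg ‖ b ‖) (I-nonNeg p q))) ⟩
             r a * √ I p q * D p q a * (r b * √ I p q * D p q b)
               ≈⟨ solve 5 (λ x i d y e → x :* i :* d :* (y :* i :* e) := x :* y :* (i :* i :* (d :* e))) refl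
                    (r a) (√ I p q) (D p q a) (r b) (D p q b) ⟩
             r a * r b * (√ I p q * √ I p q * (D p q a * D p q b))
               ≈⟨ *-congˡ (*-congʳ (√-square (I-nonNeg p q))) ⟩
             r a * r b * (I p q * (D p q a * D p q b)) ∎) ⟩
      sum (λ p → sum λ q → r a * r b * (I p q * (D p q a * D p q b)))
        ≈⟨ sum-cong-≋ (λ p → *-distribˡ-sum (r a * r b) (λ q → I p q * (D p q a * D p q b))) ⟨
      sum (λ p → r a * r b * sum λ q → I p q * (D p q a * D p q b))
        ≈⟨ *-distribˡ-sum (r a * r b) (λ p → sum λ q → I p q * (D p q a * D p q b)) ⟨
      r a * r b * N a b ∎

  -- Counting along an admissible surjective morphism

  module AdmissibleMorphism
    {n s n′ s′} (𝒳 : CoherentConfiguration n s) (𝒳′ : CoherentConfiguration n′ s′)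
    (scheme : IsAssociationScheme 𝒳) (scheme′ : IsAssociationScheme 𝒳′)
    (φ : Morphism 𝒳 𝒳′) (admissible : Morphism.IsAdmissible φ) (surjective : Morphism.IsSurjective φ) where

    module X  = Scheme 𝒳 scheme
    module X′ = Scheme 𝒳′ scheme′
    open Morphism φ

    colour-φ : ∀ x y → X′.colour (φ₀ x) (φ₀ y) ≡ φ₁ (X.colour x y)
    colour-φ x y = preserves x y _ ≡.refl

    -- Sharing a fibre is a property of the colour: it must lie over the diagonal colour. Counts
    -- inside fibres are thereby sums of structure constants.
    φ₀-fibre : ∀ y y₀ → identity (φ₀ y) (φ₀ y₀) ≡ identity (φ₁ (X.colour y y₀)) X′.i₀
    φ₀-fibre y y₀ = identity-cong {i = φ₀ y} {φ₀ y₀} {φ₁ (X.colour y y₀)} {X′.i₀}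
      (λ eq → ≡.trans (≡.sym (colour-φ y y₀)) (X′.≡⇒colour≡i₀ eq))
      (λ eq → X′.colour≡i₀⇒≡ (≡.trans (colour-φ y y₀) eq))

    -- The number of a-neighbours of a point in any fibre of φ₀ that contains one.
    m : Fin s → Carrier
    m a = sum λ b → identity (φ₁ b) X′.i₀ * X.D a b a

    -- If (φ₀ x , y′) has the wrong colour there is no a-neighbour of x over y′. Otherwise
    -- admissibility yields one, y₀, and the others y are counted through the colour b of (y , y₀):
    -- paths from x to y₀ along a and then b, with b over the diagonal. Their number depends on a
    -- alone.
    fibre-valency : ∀ x y′ a → sum (λ y → identity (φ₀ y) y′ * identity (X.colour x y) a) ≈
                               identity (X′.colour (φ₀ x) y′) (φ₁ a) * m a
    fibre-valency x y′ a = helper (X′.colour (φ₀ x) y′ ≟ φ₁ a)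
      where
      helper : Dec (X′.colour (φ₀ x) y′ ≡ φ₁ a) →
               sum (λ y → identity (φ₀ y) y′ * identity (X.colour x y) a) ≈
               identity (X′.colour (φ₀ x) y′) (φ₁ a) * m a
      helper (no neq) = trans
        (sum-zero λ y → trans
          (identity-subst (φ₀ y) y′ λ φy≡y′ → reflexive (identity-no {i = X.colour x y} λ eq →
            neq (≡.trans (≡.cong (X′.colour (φ₀ x)) (≡.sym φy≡y′))
                         (≡.trans (colour-φ x y) (≡.cong φ₁ eq)))))
          (zeroʳ (identity (φ₀ y) y′)))
        (sym (trans (*-congʳ (reflexive (identity-no {i = X′.colour (φ₀ x) y′} neq))) (zeroˡ _)))
      helper (yes eq) with admissible x y′ a (X.neighbour x a) eq
      ... | y₀ , ≡.refl , xy₀≡a = begin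
        sum (λ y → identity (φ₀ y) (φ₀ y₀) * identity (X.colour x y) a)
          ≈⟨ sum-cong-≋ {n} (λ y → *-congʳ (reflexive (φ₀-fibre y y₀))) ⟩
        sum (λ y → identity (φ₁ (X.colour y y₀)) X′.i₀ * identity (X.colour x y) a)
          ≈⟨ sum-fibres (λ y → X.colour y y₀) (λ b → identity (φ₁ b) X′.i₀) (λ y → identity (X.colour x y) a) ⟩
        sum (λ b → identity (φ₁ b) X′.i₀ * sum λ y → identity (X.colour y y₀) b * identity (X.colour x y) a)
          ≈⟨ sum-cong-≋ (λ b → *-congˡ (trans (sum-cong-≋ {n} λ y → *-comm _ _)
               (trans (X.path-sum a b x y₀) (reflexive (≡.cong (X.D a b) xy₀≡a))))) ⟩
        m a
          ≈⟨ *-identityˡ _ ⟨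
        1# * m a
          ≈⟨ *-congʳ (reflexive (identity-yes {i = X′.colour (φ₀ x) (φ₀ y₀)} eq)) ⟨
        identity (X′.colour (φ₀ x) (φ₀ y₀)) (φ₁ a) * m a ∎

    -- The a-neighbours of a point are spread over as many fibres as the valency of `φ₁ a`, with m a
    -- in each.
    w≈m*w′ : ∀ a → X.w a ≈ m a * X′.w (φ₁ a)
    w≈m*w′ a = begin
      X.w a
        ≈⟨ X.valency x a ⟨
      sum (λ y → identity (X.colour x y) a)
        ≈⟨ sum-cong-≋ {n} (λ y → *-identityˡ _) ⟨
      sum (λ y → 1# * identity (X.colour x y) a)
        ≈⟨ sum-fibres φ₀ (λ _ → 1#) (λ y → identity (X.colour x y) a) ⟩
      sum (λ y′ → 1# * sum λ y → identity (φ₀ y) y′ * identity (X.colour x y) a)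
        ≈⟨ sum-cong-≋ (λ y′ → trans (*-identityˡ _) (trans (fibre-valency x y′ a) (*-comm _ _))) ⟩
      sum (λ y′ → m a * identity (X′.colour (φ₀ x) y′) (φ₁ a))
        ≈⟨ *-distribˡ-sum (m a) (λ y′ → identity (X′.colour (φ₀ x) y′) (φ₁ a)) ⟨
      m a * sum (λ y′ → identity (X′.colour (φ₀ x) y′) (φ₁ a))
        ≈⟨ *-congˡ (X′.valency (φ₀ x) (φ₁ a)) ⟩
      m a * X′.w (φ₁ a) ∎
      where x = X.source a

    -- An arbitrary base point, available because the diagonal part is nonempty; its fibre gives `κ`
    -- as a natural number.
    x₀ : Fin n
    x₀ = X.source X.i₀

    κ : ℕ
    κ = count (λ y → φ₀ y ≟ φ₀ x₀) (allFin n)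

    κ-positive : 0 < κ
    κ-positive = count-positive (λ y → φ₀ y ≟ φ₀ x₀) id x₀ ≡.refl

    -- The fibre through x is made up of its neighbours in the colours over the diagonal, so its
    -- size is the sum of their valencies, the same for all x. Surjectivity of `φ₀` provides an x
    -- over y′.
    fibre-size : ∀ y′ → sum (λ y → identity (φ₀ y) y′) ≈ κ · 1#
    fibre-size y′ with proj₁ surjective y′
    ... | x , ≡.refl = trans (kernel-valency x) (trans (sym (kernel-valency x₀)) (sym (count-identity φ₀ (φ₀ x₀))))
      where
      kernel-valency : ∀ x → sum (λ y → identity (φ₀ y) (φ₀ x)) ≈ sum (λ b → identity (φ₁ b) X′.i₀ * X.w b)
      kernel-valency x = begin
        sum (λ y → identity (φ₀ y) (φ₀ x))
          ≈⟨ sum-cong-≋ {n} (λ y → trans (reflexive (≡.trans (identity-sym (φ₀ y) (φ₀ x)) (φ₀-fibre x y)))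
               (sym (*-identityʳ _))) ⟩
        sum (λ y → identity (φ₁ (X.colour x y)) X′.i₀ * 1#)
          ≈⟨ sum-fibres (X.colour x) (λ b → identity (φ₁ b) X′.i₀) (λ _ → 1#) ⟩
        sum (λ b → identity (φ₁ b) X′.i₀ * sum λ y → identity (X.colour x y) b * 1#)
          ≈⟨ sum-cong-≋ (λ b → *-congˡ (trans (sum-cong-≋ {n} λ y → *-identityʳ _) (X.valency x b))) ⟩
        sum (λ b → identity (φ₁ b) X′.i₀ * X.w b) ∎

    -- A_a ↦ m a A′_{φ₁ a} is a homomorphism of adjacency algebras.
    m-homomorphic : ∀ p q a′ → sum (λ a → identity (φ₁ a) a′ * (m a * X.D p q a)) ≈
                               m p * m q * X′.D (φ₁ p) (φ₁ q) a′
    m-homomorphic p q a′ with proj₁ surjective (X′.source a′)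
    -- Both sides count pairs (z , y) with (x , z) in p, (z , y) in q and y over y′. The left side
    -- sorts them by the colour of (x , y); the right side counts y for each z, then z within each
    -- fibre.
    ... | x , φx≡ = begin
      sum (λ a → identity (φ₁ a) a′ * (m a * X.D p q a))
        ≈⟨ sum-cong-≋ (λ a → trans (solve 3 (λ i m d → i :* (m :* d) := d :* (i :* m)) refl
             (identity (φ₁ a) a′) (m a) (X.D p q a))
             (*-congˡ (trans (*-congʳ (reflexive (≡.trans (identity-sym (φ₁ a) a′)
                                (≡.cong (λ b → identity b (φ₁ a)) (≡.sym xy′≡a′)))))
               (trans (sym (fibre-valency x y′ a)) (sum-cong-≋ {n} λ y → *-comm _ _))))) ⟩
      sum (λ a → X.D p q a * sum λ y → identity (X.colour x y) a * identity (φ₀ y) y′)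
        ≈⟨ sum-fibres (X.colour x) (X.D p q) (λ y → identity (φ₀ y) y′) ⟨
      sum (λ y → X.D p q (X.colour x y) * identity (φ₀ y) y′)
        ≈⟨ sum-cong-≋ {n} (λ y → *-congʳ (X.path-sum p q x y)) ⟨
      sum (λ y → sum (λ z → identity (X.colour x z) p * identity (X.colour z y) q) * identity (φ₀ y) y′)
        ≈⟨ sum-cong-≋ {n} (λ y → *-distribʳ-sum (identity (φ₀ y) y′)
             (λ z → identity (X.colour x z) p * identity (X.colour z y) q)) ⟩
      sum (λ y → sum λ z → identity (X.colour x z) p * identity (X.colour z y) q * identity (φ₀ y) y′)
        ≈⟨ ∑-comm (λ y z → identity (X.colour x z) p * identity (X.colour z y) q * identity (φ₀ y) y′) ⟩
      sum (λ z → sum λ y → identity (X.colour x z) p * identity (X.colour z y) q * identity (φ₀ y) y′)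
        ≈⟨ sum-cong-≋ {n} (λ z → trans
             (sum-cong-≋ {n} λ y → trans (*-assoc _ _ _) (*-congˡ (*-comm _ _)))
             (sym (*-distribˡ-sum (identity (X.colour x z) p)
               (λ y → identity (φ₀ y) y′ * identity (X.colour z y) q)))) ⟩
      sum (λ z → identity (X.colour x z) p * sum λ y → identity (φ₀ y) y′ * identity (X.colour z y) q)
        ≈⟨ sum-cong-≋ {n} (λ z → trans (*-comm _ _) (*-congʳ (fibre-valency z y′ q))) ⟩
      sum (λ z → identity (X′.colour (φ₀ z) y′) (φ₁ q) * m q * identity (X.colour x z) p)
        ≈⟨ sum-fibres φ₀ (λ z′ → identity (X′.colour z′ y′) (φ₁ q) * m q) (λ z → identity (X.colour x z) p) ⟩
      sum (λ z′ → identity (X′.colour z′ y′) (φ₁ q) * m q *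
        sum λ z → identity (φ₀ z) z′ * identity (X.colour x z) p)
        ≈⟨ sum-cong-≋ (λ z′ → trans (*-congˡ (fibre-valency x z′ p))
             (solve 4 (λ i m j n → i :* m :* (j :* n) := n :* m :* (j :* i)) refl
               (identity (X′.colour z′ y′) (φ₁ q)) (m q) (identity (X′.colour (φ₀ x) z′) (φ₁ p)) (m p))) ⟩
      sum (λ z′ → m p * m q * (identity (X′.colour (φ₀ x) z′) (φ₁ p) * identity (X′.colour z′ y′) (φ₁ q)))
        ≈⟨ *-distribˡ-sum (m p * m q)
             (λ z′ → identity (X′.colour (φ₀ x) z′) (φ₁ p) * identity (X′.colour z′ y′) (φ₁ q)) ⟨
      m p * m q * sum (λ z′ → identity (X′.colour (φ₀ x) z′) (φ₁ p) * identity (X′.colour z′ y′) (φ₁ q))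
        ≈⟨ *-congˡ (trans (X′.path-sum (φ₁ p) (φ₁ q) (φ₀ x) y′)
             (reflexive (≡.cong (X′.D (φ₁ p) (φ₁ q)) xy′≡a′))) ⟩
      m p * m q * X′.D (φ₁ p) (φ₁ q) a′ ∎
      where
      y′ = X′.target a′
      xy′≡a′ : X′.colour (φ₀ x) y′ ≡ a′
      xy′≡a′ = ≡.trans (≡.cong (λ x′ → X′.colour x′ y′) φx≡) (X′.colour-source-target a′)

    -- The adjoint counterpart of m-homomorphic.
    fibrewise-D : ∀ p′ q′ b →
      sum (λ p → identity (φ₁ p) p′ * sum λ q → identity (φ₁ q) q′ * X.D p q b) ≈
      κ · 1# * X′.D p′ q′ (φ₁ b)
    fibrewise-D p′ q′ b = begin
      sum (λ p → identity (φ₁ p) p′ * sum λ q → identity (φ₁ q) q′ * X.D p q b)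
        ≡⟨ ≡.cong (λ b → sum λ p → identity (φ₁ p) p′ * sum λ q → identity (φ₁ q) q′ * X.D p q b)
             (X.colour-source-target b) ⟨
      sum (λ p → identity (φ₁ p) p′ * sum λ q → identity (φ₁ q) q′ * X.D p q (X.colour x y))
        ≈⟨ X.weighted-path-sum (λ p → identity (φ₁ p) p′) (λ q → identity (φ₁ q) q′) x y ⟨
      sum (λ z → identity (φ₁ (X.colour x z)) p′ * identity (φ₁ (X.colour z y)) q′)
        ≈⟨ sum-cong-≋ {n} (λ z → trans (*-identityʳ _) (reflexive (≡.cong₂ (λ u v → identity u p′ * identity v q′)
             (colour-φ x z) (colour-φ z y)))) ⟨
      sum (λ z → identity (X′.colour (φ₀ x) (φ₀ z)) p′ * identity (X′.colour (φ₀ z) (φ₀ y)) q′ * 1#)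
        -- The summand depends on z through `φ₀ z` only, so each z′ is counted once for each of its
        -- κ lifts.
        ≈⟨ sum-fibres φ₀ (λ z′ → identity (X′.colour (φ₀ x) z′) p′ * identity (X′.colour z′ (φ₀ y)) q′) (λ _ → 1#) ⟩
      sum (λ z′ → identity (X′.colour (φ₀ x) z′) p′ * identity (X′.colour z′ (φ₀ y)) q′ *
        sum λ z → identity (φ₀ z) z′ * 1#)
        ≈⟨ sum-cong-≋ (λ z′ → trans (*-congˡ (trans (sum-cong-≋ {n} λ z → *-identityʳ _) (fibre-size z′))) (*-comm _ _)) ⟩
      sum (λ z′ → κ · 1# * (identity (X′.colour (φ₀ x) z′) p′ * identity (X′.colour z′ (φ₀ y)) q′))
        ≈⟨ *-distribˡ-sum (κ · 1#) (λ z′ → identity (X′.colour (φ₀ x) z′) p′ * identity (X′.colour z′ (φ₀ y)) q′) ⟨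
      κ · 1# * sum (λ z′ → identity (X′.colour (φ₀ x) z′) p′ * identity (X′.colour z′ (φ₀ y)) q′)
        ≈⟨ *-congˡ (trans (X′.path-sum p′ q′ (φ₀ x) (φ₀ y)) (reflexive (≡.cong (X′.D p′ q′)
             (≡.trans (colour-φ x y) (≡.cong φ₁ (X.colour-source-target b)))))) ⟩
      κ · 1# * X′.D p′ q′ (φ₁ b) ∎
      where
      x = X.source b
      y = X.target b

    k : Carrier
    k = κ · 1#

    -- By `w≈m*w′`, the multiplicities turn the normalisation of the source into that of the target,
    -- which depends on the images of p and q only.
    m*m*I : ∀ p q → m p * m q * X.I p q ≈ X′.I (φ₁ p) (φ₁ q)
    m*m*I p q = begin
      m p * m q * X.I p q
        ≈⟨ *-identityʳ _ ⟨
      m p * m q * X.I p q * 1#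
        ≈⟨ *-congˡ (⁻¹-inverseʳ (X′.w*w≉0 (φ₁ p) (φ₁ q))) ⟨
      m p * m q * X.I p q * (X′.w (φ₁ p) * X′.w (φ₁ q) * X′.I (φ₁ p) (φ₁ q))
        ≈⟨ solve 6 (λ a b i v w j → a :* b :* i :* (v :* w :* j) := a :* v :* (b :* w) :* i :* j) refl
             (m p) (m q) (X.I p q) (X′.w (φ₁ p)) (X′.w (φ₁ q)) (X′.I (φ₁ p) (φ₁ q)) ⟩
      m p * X′.w (φ₁ p) * (m q * X′.w (φ₁ q)) * X.I p q * X′.I (φ₁ p) (φ₁ q)
        ≈⟨ *-congʳ (*-congʳ (*-cong (w≈m*w′ p) (w≈m*w′ q))) ⟨
      X.w p * X.w q * X.I p q * X′.I (φ₁ p) (φ₁ q)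
        ≈⟨ *-congʳ (⁻¹-inverseʳ (X.w*w≉0 p q)) ⟩
      1# * X′.I (φ₁ p) (φ₁ q)
        ≈⟨ *-identityˡ _ ⟩
      X′.I (φ₁ p) (φ₁ q) ∎

    -- Summing over a first, `m-homomorphic` carries one of the two structure constants to the
    -- target. Of the source, only the constant at b then remains; summing p and q over fibres of
    -- `φ₁` replaces it by `fibrewise-D`, where k appears.
    N-intertwined : ∀ a′ b → sum (λ a → identity (φ₁ a) a′ * (m a * X.N a b)) ≈ k * X′.N a′ (φ₁ b)
    N-intertwined a′ b = begin
      sum (λ a → identity (φ₁ a) a′ * (m a * X.N a b))
        ≈⟨ sum-cong-≋ (λ a → trans (sym (*-assoc _ _ _)) (trans
             (*-distribˡ-sum (identity (φ₁ a) a′ * m a) (λ p → sum λ q → X.I p q * (X.D p q a * X.D p q b)))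
             (sum-cong-≋ λ p → trans
               (*-distribˡ-sum (identity (φ₁ a) a′ * m a) (λ q → X.I p q * (X.D p q a * X.D p q b)))
               (sum-cong-≋ λ q → solve 5 (λ i m j d e → i :* m :* (j :* (d :* e)) := j :* e :* (i :* (m :* d))) refl
                 (identity (φ₁ a) a′) (m a) (X.I p q) (X.D p q a) (X.D p q b))))) ⟩
      sum (λ a → sum λ p → sum λ q → X.I p q * X.D p q b * (identity (φ₁ a) a′ * (m a * X.D p q a)))
        ≈⟨ ∑-comm (λ a p → sum λ q → X.I p q * X.D p q b * (identity (φ₁ a) a′ * (m a * X.D p q a))) ⟩
      sum (λ p → sum λ a → sum λ q → X.I p q * X.D p q b * (identity (φ₁ a) a′ * (m a * X.D p q a)))
        ≈⟨ sum-cong-≋ (λ p → ∑-comm (λ a q → X.I p q * X.D p q b * (identity (φ₁ a) a′ * (m a * X.D p q a)))) ⟩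
      sum (λ p → sum λ q → sum λ a → X.I p q * X.D p q b * (identity (φ₁ a) a′ * (m a * X.D p q a)))
        ≈⟨ sum-cong-≋ (λ p → sum-cong-≋ λ q →
             *-distribˡ-sum (X.I p q * X.D p q b) (λ a → identity (φ₁ a) a′ * (m a * X.D p q a))) ⟨
      sum (λ p → sum λ q → X.I p q * X.D p q b * sum λ a → identity (φ₁ a) a′ * (m a * X.D p q a))
        ≈⟨ sum-cong-≋ (λ p → sum-cong-≋ λ q → begin
             X.I p q * X.D p q b * sum (λ a → identity (φ₁ a) a′ * (m a * X.D p q a))
               ≈⟨ *-congˡ (m-homomorphic p q a′) ⟩
             X.I p q * X.D p q b * (m p * m q * X′.D (φ₁ p) (φ₁ q) a′)
               ≈⟨ solve 5 (λ i e m n d → i :* e :* (m :* n :* d) := m :* n :* i :* d :* e) refl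
                    (X.I p q) (X.D p q b) (m p) (m q) (X′.D (φ₁ p) (φ₁ q) a′) ⟩
             m p * m q * X.I p q * X′.D (φ₁ p) (φ₁ q) a′ * X.D p q b
               ≈⟨ *-congʳ (*-congʳ (m*m*I p q)) ⟩
             X′.I (φ₁ p) (φ₁ q) * X′.D (φ₁ p) (φ₁ q) a′ * X.D p q b ∎) ⟩
      sum (λ p → sum λ q → X′.I (φ₁ p) (φ₁ q) * X′.D (φ₁ p) (φ₁ q) a′ * X.D p q b)
        ≈⟨ sum-fibres₂ φ₁ (λ p′ q′ → X′.I p′ q′ * X′.D p′ q′ a′) (λ p q → X.D p q b) ⟩
      sum (λ p′ → sum λ q′ → X′.I p′ q′ * X′.D p′ q′ a′ *
        sum λ p → identity (φ₁ p) p′ * sum λ q → identity (φ₁ q) q′ * X.D p q b)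
        ≈⟨ sum-cong-≋ (λ p′ → trans
             (sum-cong-≋ λ q′ → trans (*-congˡ (fibrewise-D p′ q′ b))
               (solve 4 (λ i d k e → i :* d :* (k :* e) := k :* (i :* (d :* e))) refl
                 (X′.I p′ q′) (X′.D p′ q′ a′) k (X′.D p′ q′ (φ₁ b))))
             (sym (*-distribˡ-sum k (λ q′ → X′.I p′ q′ * (X′.D p′ q′ a′ * X′.D p′ q′ (φ₁ b)))))) ⟩
      sum (λ p′ → k * sum λ q′ → X′.I p′ q′ * (X′.D p′ q′ a′ * X′.D p′ q′ (φ₁ b)))
        ≈⟨ *-distribˡ-sum k (λ p′ → sum λ q′ → X′.I p′ q′ * (X′.D p′ q′ a′ * X′.D p′ q′ (φ₁ b))) ⟨
      k * X′.N a′ (φ₁ b) ∎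

    -- σ a is the square root of m a.
    σ : Fin s → Carrier
    σ a = X.r a * (X′.r (φ₁ a)) ⁻¹

    r′*σ≈r : ∀ a → X′.r (φ₁ a) * σ a ≈ X.r a
    r′*σ≈r a = trans
      (solve 3 (λ x y z → x :* (y :* z) := x :* z :* y) refl (X′.r (φ₁ a)) (X.r a) ((X′.r (φ₁ a)) ⁻¹))
      (trans (*-congʳ (⁻¹-inverseʳ (X′.r≉0 (φ₁ a)))) (*-identityˡ _))

    σ*r≈m*r′ : ∀ a → σ a * X.r a ≈ m a * X′.r (φ₁ a)
    σ*r≈m*r′ a = *-cancelˡ-≈ (X′.r≉0 (φ₁ a)) (begin
      X′.r (φ₁ a) * (σ a * X.r a)        ≈⟨ *-assoc _ _ _ ⟨
      X′.r (φ₁ a) * σ a * X.r a          ≈⟨ *-congʳ (r′*σ≈r a) ⟩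
      X.r a * X.r a                      ≈⟨ X.r² a ⟩
      X.w a                              ≈⟨ w≈m*w′ a ⟩
      m a * X′.w (φ₁ a)                  ≈⟨ *-congˡ (X′.r² (φ₁ a)) ⟨
      m a * (X′.r (φ₁ a) * X′.r (φ₁ a))
        ≈⟨ solve 2 (λ m r → m :* (r :* r) := r :* (m :* r)) refl (m a) (X′.r (φ₁ a)) ⟩
      X′.r (φ₁ a) * (m a * X′.r (φ₁ a))  ∎)

    P : Rows s′ s
    P a′ a = identity (φ₁ a) a′ * σ a

    kO′ : Matrix s′
    kO′ a′ b′ = k * O 𝒳′ a′ b′

    -- `N-intertwined` with the roots restored: the row root becomes `X′.r a′` by `σ*r≈m*r′`, and
    -- the column root splits as `X′.r (φ₁ b) * σ b`. The two target roots rebuild the matrix of the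
    -- target, and σ b is the entry of P.
    O-intertwined : ∀ a′ b → (P ⊗ O 𝒳) a′ b ≈ (kO′ ⊗ P) a′ b
    O-intertwined a′ b = begin
      sum (λ a → identity (φ₁ a) a′ * σ a * O 𝒳 a b)
        ≈⟨ sum-cong-≋ (λ a → begin
             identity (φ₁ a) a′ * σ a * O 𝒳 a b
               ≈⟨ *-congˡ (X.O-factor a b) ⟩
             identity (φ₁ a) a′ * σ a * (X.r a * X.r b * X.N a b)
               ≈⟨ solve 5 (λ i σ r t n → i :* σ :* (r :* t :* n) := i :* (σ :* r :* (t :* n))) refl
                    (identity (φ₁ a) a′) (σ a) (X.r a) (X.r b) (X.N a b) ⟩
             identity (φ₁ a) a′ * (σ a * X.r a * (X.r b * X.N a b))
               ≈⟨ identity-subst (φ₁ a) a′ (λ eq → *-congʳ (trans (σ*r≈m*r′ a)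
                    (*-congˡ (reflexive (≡.cong X′.r eq))))) ⟩
             identity (φ₁ a) a′ * (m a * X′.r a′ * (X.r b * X.N a b))
               ≈⟨ solve 5 (λ i m r t n → i :* (m :* r :* (t :* n)) := r :* t :* (i :* (m :* n))) refl
                    (identity (φ₁ a) a′) (m a) (X′.r a′) (X.r b) (X.N a b) ⟩
             X′.r a′ * X.r b * (identity (φ₁ a) a′ * (m a * X.N a b)) ∎) ⟩
      sum (λ a → X′.r a′ * X.r b * (identity (φ₁ a) a′ * (m a * X.N a b)))
        ≈⟨ *-distribˡ-sum (X′.r a′ * X.r b) (λ a → identity (φ₁ a) a′ * (m a * X.N a b)) ⟨
      X′.r a′ * X.r b * sum (λ a → identity (φ₁ a) a′ * (m a * X.N a b))
        ≈⟨ *-cong (*-congˡ (sym (r′*σ≈r b))) (N-intertwined a′ b) ⟩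
      X′.r a′ * (X′.r (φ₁ b) * σ b) * (k * X′.N a′ (φ₁ b))
        ≈⟨ solve 5 (λ r t σ k n → r :* (t :* σ) :* (k :* n) := k :* (r :* t :* n) :* σ) refl
             (X′.r a′) (X′.r (φ₁ b)) (σ b) k (X′.N a′ (φ₁ b)) ⟩
      k * (X′.r a′ * X′.r (φ₁ b) * X′.N a′ (φ₁ b)) * σ b
        ≈⟨ *-congʳ (*-congˡ (X′.O-factor a′ (φ₁ b))) ⟨
      kO′ a′ (φ₁ b) * σ b
        ≈⟨ sum-identity (φ₁ b) (λ b′ → kO′ a′ b′ * σ b) ⟨
      sum (λ b′ → identity (φ₁ b) b′ * (kO′ a′ b′ * σ b))
        ≈⟨ sum-cong-≋ (λ b′ → solve 3 (λ i o σ → i :* (o :* σ) := o :* (i :* σ)) refl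
             (identity (φ₁ b) b′) (kO′ a′ b′) (σ b)) ⟩
      sum (λ b′ → kO′ a′ b′ * (identity (φ₁ b) b′ * σ b)) ∎

    -- One colour over each target colour: on these columns P is diagonal with invertible entries σ,
    -- which exhibits its full row rank.
    section : Fin s′ → Fin s
    section a′ = proj₁ (proj₂ surjective a′)

    φ₁-section : ∀ a′ → φ₁ (section a′) ≡ a′
    φ₁-section a′ = proj₂ (proj₂ surjective a′)

    section-injective : Injective _≡_ _≡_ section
    section-injective {a} {b} eq =
      ≡.trans (≡.sym (φ₁-section a)) (≡.trans (≡.cong φ₁ eq) (φ₁-section b))

    charPoly-factor : ∃₂ λ t (C : Matrix t) → ∀ x → charPoly (O 𝒳) x ≈ charPoly kO′ x * charPoly C x
    charPoly-factor = charPoly-intertwined (O 𝒳) kO′ P O-intertwined section section-injective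
      (σ ∘ section) (σ⁻¹ ∘ section) (σ*σ⁻¹≈1 ∘ section)
      (λ a′ b′ → *-congʳ (reflexive (≡.trans (≡.cong (λ c → identity c a′) (φ₁-section b′)) (identity-sym b′ a′))))
      where
      σ⁻¹ : Fin s → Carrier
      σ⁻¹ a = X′.r (φ₁ a) * (X.r a) ⁻¹
      σ*σ⁻¹≈1 : ∀ a → σ a * σ⁻¹ a ≈ 1#
      σ*σ⁻¹≈1 a = begin
        σ a * (X′.r (φ₁ a) * (X.r a) ⁻¹)  ≈⟨ *-assoc _ _ _ ⟨
        σ a * X′.r (φ₁ a) * (X.r a) ⁻¹    ≈⟨ *-congʳ (trans (*-comm _ _) (r′*σ≈r a)) ⟩
        X.r a * (X.r a) ⁻¹                ≈⟨ ⁻¹-inverseʳ (X.r≉0 a) ⟩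
        1#                                ∎

    k≉0 : ¬ (k ≈ 0#)
    k≉0 = ·1≉0 κ (m<n⇒n≢0 κ-positive)

    eigenvalues : ∀ λs → IsEigenvalueVector (O 𝒳′) λs → ∀ μs → IsEigenvalueVector (O 𝒳) μs →
                  IsSubvector (λ i → κ · λs i) μs
    eigenvalues λs eigen′ μs eigen =
      let _ , C , factor = charPoly-factor in
      subvector (λ i → κ · λs i) μs (isPolynomial-charPoly C) λ t → begin
        product (λ i → t - μs i)
          ≈⟨ eigen t ⟨
        charPoly (O 𝒳) t
          ≈⟨ factor t ⟩
        charPoly kO′ t * charPoly C t
          ≈⟨ *-congʳ (scaled-eigenvalues (O 𝒳′) λs k k≉0 eigen′ t) ⟩
        product (λ i → t - k * λs i) * charPoly C t
          ≈⟨ *-congʳ (Product.sum-cong-≋ λ i → +-congˡ (-‿cong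
               (trans (×-assoc-* κ 1# (λs i)) (×-congʳ κ (*-identityˡ (λs i)))))) ⟩
        product (λ i → t - κ · λs i) * charPoly C t ∎

theorem9p7 : ∀ {c ℓ₁ ℓ₂} (ℝ : Reals c ℓ₁ ℓ₂) →
    let open Reals ℝ using (Carrier)
        open LinearAlgebra ℝ
    in
    ∀ {n s n′ s′ : ℕ}
    (𝒳 : CoherentConfiguration n s) (𝒳′ : CoherentConfiguration n′ s′) →
    IsAssociationScheme 𝒳 → IsAssociationScheme 𝒳′ →
    (φ : Morphism 𝒳 𝒳′) → Morphism.IsAdmissible φ → Morphism.IsSurjective φ →
    (λs : Vector Carrier s′) → IsEigenvalueVector (O 𝒳′) λs →
    ∃ λ (k : ℕ) → 0 < k ×
      ((μs : Vector Carrier s) → IsEigenvalueVector (O 𝒳) μs →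
       IsSubvector (λ i → k · λs i) μs)
theorem9p7 ℝ 𝒳 𝒳′ scheme scheme′ φ admissible surjective λs eigen′ =
  κ , κ-positive , eigenvalues λs eigen′
  where open Spectra.AdmissibleMorphism ℝ 𝒳 𝒳′ scheme scheme′ φ admissible surjective
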